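{- Over ZF, the axiom of choice is equivalent to the statement: every partial order $(\mathbb{P},\unlhd)$ contains a maximal antichain (in the sense of incompatibility).
   Context: Let $(\mathbb{P},\unlhd)$ be a partial order. Elements $p,q\in\mathbb{P}$ are compatible iff there exists $r\in\mathbb{P}$ with $r\unlhd p$ and $r\unlhd q$; otherwise they are incompatible. A subset $A\subseteq\mathbb{P}$ is an antichain iff any two distinct elements of $A$ are incompatible. An antichain $A$ is maximal iff every $p\in\mathbb{P}$ is compatible with some $q\in A$. -}

module Defs where

open import Data.Fin.Base using (Fin; zero; suc; lift)
open import Data.List.Base as List using (List; [])
open import Data.List.Membership.Propositional using () renaming (_∈_ to _∈ᴸ_)
open import Data.Nat.Base using (ℕ; zero; suc)
open import Data.Vec.Functional using (_∷_)
open import Function.Base using (id)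
open import Level using (0ℓ)
open import Relation.Unary using (Pred)

-- First-order formulas over the signature {∈} with equality, in de Bruijn
-- style: Formula n has its free variables in Fin n, index zero being the most
-- recently bound one.  The language has no function symbols, so variables are
-- the only terms and substitution is renaming.

infix  7 _∈_ _≐_
infix  6 ¬_
infixr 5 _∧_
infixr 4 _∨_
infixr 3 _⇒_
infix  2 _⇔_
infixr 1 ∀′_ ∃′_ ∀[∈_]_ ∃[∈_]_

data Formula : ℕ → Set where
  _∈_ _≐_ : ∀ {n} → Fin n → Fin n → Formula n
  ⊥       : ∀ {n} → Formula n
  _⇒_     : ∀ {n} → Formula n → Formula n → Formula n
  ∀′_     : ∀ {n} → Formula (suc n) → Formula n

Sentence : Set
Sentence = Formula 0

Theory : Set₁
Theory = Pred Sentence 0ℓ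

¬_ : ∀ {n} → Formula n → Formula n
¬ φ = φ ⇒ ⊥

_∧_ _∨_ _⇔_ : ∀ {n} → Formula n → Formula n → Formula n
φ ∧ ψ = ¬ (φ ⇒ ¬ ψ)
φ ∨ ψ = ¬ φ ⇒ ψ
φ ⇔ ψ = (φ ⇒ ψ) ∧ (ψ ⇒ φ)

∃′_ : ∀ {n} → Formula (suc n) → Formula n
∃′ φ = ¬ (∀′ ¬ φ)

∀[∈_]_ ∃[∈_]_ : ∀ {n} → Fin n → Formula (suc n) → Formula n
∀[∈ x ] φ = ∀′ zero ∈ suc x ⇒ φ
∃[∈ x ] φ = ∃′ zero ∈ suc x ∧ φ

rename : ∀ {m n} → (Fin m → Fin n) → Formula m → Formula n
rename ρ (x ∈ y) = ρ x ∈ ρ y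
rename ρ (x ≐ y) = ρ x ≐ ρ y
rename ρ ⊥       = ⊥
rename ρ (φ ⇒ ψ) = rename ρ φ ⇒ rename ρ ψ
rename ρ (∀′ φ)  = ∀′ rename (lift 1 ρ) φ

_[_] : ∀ {n} → Formula (suc n) → Fin n → Formula n
φ [ x ] = rename (x ∷ id) φ

closure : ∀ n → Formula n → Sentence
closure zero    φ = φ
closure (suc n) φ = closure n (∀′ φ)

-- Classical natural deduction from a theory T.  The variables in scope are
-- part of the judgement, so with n = 0 there is no term with which to
-- instantiate a quantifier and the pure logic does not prove that the universe
-- is inhabited; in ZF this follows from Infinity.

infix 0 _∣_⊢_ _⊢_

data _∣_⊢_ (T : Theory) : ∀ {n} → List (Formula n) → Formula n → Set where
  axiom   : ∀ {n} {Γ : List (Formula n)} {φ : Sentence} →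
            T φ → T ∣ Γ ⊢ rename (λ ()) φ
  assume  : ∀ {n} {Γ : List (Formula n)} {φ} →
            φ ∈ᴸ Γ → T ∣ Γ ⊢ φ
  ⇒-intro : ∀ {n} {Γ : List (Formula n)} {φ ψ} →
            T ∣ φ List.∷ Γ ⊢ ψ → T ∣ Γ ⊢ φ ⇒ ψ
  ⇒-elim  : ∀ {n} {Γ : List (Formula n)} {φ ψ} →
            T ∣ Γ ⊢ φ ⇒ ψ → T ∣ Γ ⊢ φ → T ∣ Γ ⊢ ψ
  by-contradiction : ∀ {n} {Γ : List (Formula n)} {φ} →
            T ∣ ¬ φ List.∷ Γ ⊢ ⊥ → T ∣ Γ ⊢ φ
  ∀-intro : ∀ {n} {Γ : List (Formula n)} {φ} →
            T ∣ List.map (rename suc) Γ ⊢ φ → T ∣ Γ ⊢ ∀′ φ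
  ∀-elim  : ∀ {n} {Γ : List (Formula n)} {φ} →
            T ∣ Γ ⊢ ∀′ φ → (x : Fin n) → T ∣ Γ ⊢ φ [ x ]
  ≐-refl  : ∀ {n} {Γ : List (Formula n)} (x : Fin n) →
            T ∣ Γ ⊢ x ≐ x
  ≐-subst : ∀ {n} {Γ : List (Formula n)} (φ : Formula (suc n)) {x y} →
            T ∣ Γ ⊢ x ≐ y → T ∣ Γ ⊢ φ [ x ] → T ∣ Γ ⊢ φ [ y ]

_⊢_ : Theory → Sentence → Set
T ⊢ φ = T ∣ [] ⊢ φ

pattern v0 = zero
pattern v1 = suc v0
pattern v2 = suc v1
pattern v3 = suc v2

_⊆_ : ∀ {n} → Fin n → Fin n → Formula n
x ⊆ y = ∀[∈ x ] v0 ∈ suc y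

Empty : ∀ {n} → Fin n → Formula n
Empty x = ∀′ ¬ v0 ∈ suc x

-- y = x ∪ {x}
IsSuccessor : ∀ {n} → Fin n → Fin n → Formula n
IsSuccessor y x = ∀′ v0 ∈ suc y ⇔ v0 ∈ suc x ∨ v0 ≐ suc x

-- z = {x , y}
IsUnorderedPair : ∀ {n} → Fin n → Fin n → Fin n → Formula n
IsUnorderedPair z x y = ∀′ v0 ∈ suc z ⇔ v0 ≐ suc x ∨ v0 ≐ suc y

-- p = {{x} , {x , y}}, the Kuratowski pair
IsPair : ∀ {n} → Fin n → Fin n → Fin n → Formula n
IsPair p x y =
  ∀′ v0 ∈ suc p ⇔
     IsUnorderedPair v0 (suc x) (suc x) ∨ IsUnorderedPair v0 (suc x) (suc y)

⟨_,_⟩∈_ : ∀ {n} → Fin n → Fin n → Fin n → Formula n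
⟨ x , y ⟩∈ r = ∃[∈ r ] IsPair v0 (suc x) (suc y)

extensionality foundation pairing union powerSet infinity : Sentence

extensionality = ∀′ ∀′ (∀′ v0 ∈ v2 ⇔ v0 ∈ v1) ⇒ v1 ≐ v0

foundation = ∀′ (∃′ v0 ∈ v1) ⇒ (∃[∈ v0 ] ¬ (∃′ v0 ∈ v1 ∧ v0 ∈ v2))

pairing = ∀′ ∀′ ∃′ IsUnorderedPair v0 v2 v1

union = ∀′ ∃′ ∀′ v0 ∈ v1 ⇔ (∃[∈ v2 ] v1 ∈ v0)

powerSet = ∀′ ∃′ ∀′ v0 ∈ v1 ⇔ v0 ⊆ v2

infinity = ∃′ (∃[∈ v0 ] Empty v0) ∧ (∀[∈ v0 ] ∃[∈ v1 ] IsSuccessor v0 v1)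

-- For φ(x , a , parameters), with x = v0 and a = v1:
-- ∀ a ∃ b ∀ x (x ∈ b ⇔ x ∈ a ∧ φ(x , a)).
separation : ∀ {k} → Formula (suc (suc k)) → Formula k
separation φ = ∀′ ∃′ ∀′ v0 ∈ v1 ⇔ v0 ∈ v2 ∧ rename (lift 1 suc) φ

-- For φ(y , x , a , parameters), with y = v0, x = v1 and a = v2:
-- ∀ a (∀ x y z (φ(y , x , a) ∧ φ(z , x , a) ⇒ y = z)
--      ⇒ ∃ b ∀ y (y ∈ b ⇔ ∃ x ∈ a φ(y , x , a))).
replacement : ∀ {k} → Formula (suc (suc (suc k))) → Formula k
replacement φ =
  ∀′ (∀′ ∀′ ∀′ rename suc φ ∧ rename (lift 1 suc) φ ⇒ v1 ≐ v0)
     ⇒ (∃′ ∀′ v0 ∈ v1 ⇔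
          (∃[∈ v2 ] rename (v1 ∷ v0 ∷ λ i → suc (suc (suc i))) φ))

data ZF : Theory where
  extensionality-ax : ZF extensionality
  foundation-ax     : ZF foundation
  pairing-ax        : ZF pairing
  union-ax          : ZF union
  powerSet-ax       : ZF powerSet
  infinity-ax       : ZF infinity
  separation-ax     : ∀ k (φ : Formula (suc (suc k))) →
                      ZF (closure k (separation φ))
  replacement-ax    : ∀ k (φ : Formula (suc (suc (suc k)))) →
                      ZF (closure k (replacement φ))

IsFunction : ∀ {n} → Fin n → Formula n
IsFunction f =
    (∀[∈ f ] ∃′ ∃′ IsPair v2 v1 v0)
  ∧ (∀′ ∀′ ∀′ ⟨ v2 , v1 ⟩∈ suc (suc (suc f)) ∧ ⟨ v2 , v0 ⟩∈ suc (suc (suc f))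
       ⇒ v1 ≐ v0)

HasDomain : ∀ {n} → Fin n → Fin n → Formula n
HasDomain f d = ∀′ v0 ∈ suc d ⇔ (∃′ ⟨ v1 , v0 ⟩∈ suc (suc f))

IsChoiceFunction : ∀ {n} → Fin n → Fin n → Formula n
IsChoiceFunction f F =
    IsFunction f
  ∧ HasDomain f F
  ∧ (∀[∈ F ] ∃[∈ v0 ] ⟨ v1 , v0 ⟩∈ suc (suc f))

AxiomOfChoice : Sentence
AxiomOfChoice =
  ∀′ (∀[∈ v0 ] ¬ Empty v0) ⇒ (∃′ IsChoiceFunction v0 v1)

-- In what follows P is the underlying set of the order and R the set of pairs
-- ⟨ x , y ⟩ with x ⊴ y.

IsRelationOn : ∀ {n} → Fin n → Fin n → Formula n
IsRelationOn R P =
  ∀[∈ R ] ∃[∈ suc P ] ∃[∈ suc (suc P) ] IsPair v2 v1 v0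

IsReflexive IsAntisymmetric IsTransitive :
  ∀ {n} → Fin n → Fin n → Formula n
IsReflexive P R = ∀[∈ P ] ⟨ v0 , v0 ⟩∈ suc R
IsAntisymmetric P R =
  ∀[∈ P ] ∀[∈ suc P ]
    ⟨ v1 , v0 ⟩∈ suc (suc R) ∧ ⟨ v0 , v1 ⟩∈ suc (suc R) ⇒ v1 ≐ v0
IsTransitive P R =
  ∀[∈ P ] ∀[∈ suc P ] ∀[∈ suc (suc P) ]
    ⟨ v2 , v1 ⟩∈ suc (suc (suc R)) ∧ ⟨ v1 , v0 ⟩∈ suc (suc (suc R))
    ⇒ ⟨ v2 , v0 ⟩∈ suc (suc (suc R))

IsPartialOrder : ∀ {n} → Fin n → Fin n → Formula n
IsPartialOrder P R =
  IsRelationOn R P ∧ IsReflexive P R ∧ IsAntisymmetric P R ∧ IsTransitive P R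

Compatible : ∀ {n} → Fin n → Fin n → Fin n → Fin n → Formula n
Compatible P R p q =
  ∃[∈ P ] ⟨ v0 , suc p ⟩∈ suc R ∧ ⟨ v0 , suc q ⟩∈ suc R

IsAntichain : ∀ {n} → Fin n → Fin n → Fin n → Formula n
IsAntichain P R A =
    A ⊆ P
  ∧ (∀[∈ A ] ∀[∈ suc A ]
       ¬ v1 ≐ v0 ⇒ ¬ Compatible (suc (suc P)) (suc (suc R)) v1 v0)

IsMaximalAntichain : ∀ {n} → Fin n → Fin n → Fin n → Formula n
IsMaximalAntichain P R A =
    IsAntichain P R A
  ∧ (∀[∈ P ] ∃[∈ suc A ] Compatible (suc (suc P)) (suc (suc R)) v1 v0)

MaximalAntichainPrinciple : Sentence
MaximalAntichainPrinciple =
  ∀′ ∀′ IsPartialOrder v1 v0 ⇒ (∃′ IsMaximalAntichain v2 v1 v0)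

{-# OPTIONS --safe #-}

-- By a completeness theorem it suffices to argue in every model of ZF.  Krivine
-- gave one that is intuitionistically valid: the models are Tarskian, but the
-- interpretation of ⊥ is an arbitrary type, and here it is T ⊢ φ₀ for the
-- sentence φ₀ to be proved.  Atomic formulas are ¬¬-stable relative to it, so
-- that inside a model classical set theory is written as ordinary Agda.
--
-- From antichains to choice: order the triples (X , x , n) with x ∈ X ∈ F and
-- n ∈ ω by letting (X , x , n) lie strictly below (X , y , m) whenever m ∈ n.
-- Triples are compatible exactly when their first components agree, so a
-- maximal antichain picks one triple, hence one x ∈ X, for each X ∈ F.
--
-- From choice to antichains: extend a set A ⊆ P by a chosen element among those
-- incompatible with every element of A.  The least family K closed under this
-- step and under arbitrary unions is a chain of antichains (as in Zermelo's
-- proof of the well-ordering theorem), and its union, being a member of K that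
-- no step enlarges, is maximal.

module Submission where

open import Data.Fin.Base using (Fin; zero; suc; toℕ; fromℕ<; opposite; lift)
open import Data.Fin.Properties
  using (toℕ-fromℕ; toℕ-fromℕ<; toℕ-injective; opposite-involutive; opposite-suc)
open import Data.List.Base
  using (List; []; _∷_; _++_; map; drop; allFin; cartesianProductWith; length)
open import Data.List.Membership.Propositional using () renaming (_∈_ to _∈ᴸ_)
open import Data.List.Membership.Propositional.Properties
  using (∈-map⁺; ∈-map⁻; ∈-++⁺ˡ; ∈-++⁺ʳ; ∈-∃++; ∈-allFin; ∈-cartesianProductWith⁺)
open import Data.List.Properties using (map-++; ++-assoc; length-map)
open import Data.List.Relation.Binary.Subset.Propositional using () renaming (_⊆_ to _⊆ᴸ_)
open import Data.List.Relation.Binary.Subset.Propositional.Properties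
  using (xs⊆xs++ys; xs⊆ys++xs; ∷⁺ʳ)
open import Data.List.Relation.Unary.All using (All; []; _∷_) renaming (map to All-map)
open import Data.List.Relation.Unary.All.Properties
  using () renaming (++⁺ to All-++⁺; map⁺ to All-map⁺)
open import Data.List.Relation.Unary.Any using (here; there)
open import Data.Nat.Base
  using (ℕ; zero; suc; _+_; _≤_; _<_; _⊔_; _≤′_; ≤′-step; ≤′-reflexive; s≤s)
open import Data.Nat.Properties
  using (m≤m⊔n; m≤n⊔m; ≤⇒≤′; <-≤-trans; m⊔n≤o⇒m≤o; m⊔n≤o⇒n≤o; suc-injective; m≤m+n; +-suc)
open import Data.Product using (Σ; Σ-syntax; ∃-syntax; _×_; _,_; proj₁; proj₂)
open import Data.Sum using (_⊎_; inj₁; inj₂)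
open import Data.Vec.Functional using () renaming (_∷_ to _◂_; [] to []ᶠ)
open import Function.Base using (id; _∘_)
open import Relation.Binary.PropositionalEquality
  using (_≡_; _≗_; refl; sym; trans; cong; cong₂; subst)
open import Relation.Unary using (Pred)
open import Level using (0ℓ)

open import Defs

-- Renaming and weakening

private
  variable
    k m n : ℕ

lift-cong : {ρ σ : Fin m → Fin n} → ρ ≗ σ → lift 1 ρ ≗ lift 1 σ
lift-cong ρ≗σ zero    = refl
lift-cong ρ≗σ (suc i) = cong suc (ρ≗σ i)

rename-cong : {ρ σ : Fin m → Fin n} → ρ ≗ σ → rename ρ ≗ rename σ
rename-cong ρ≗σ (x ∈ y) = cong₂ _∈_ (ρ≗σ x) (ρ≗σ y)
rename-cong ρ≗σ (x ≐ y) = cong₂ _≐_ (ρ≗σ x) (ρ≗σ y)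
rename-cong ρ≗σ ⊥       = refl
rename-cong ρ≗σ (φ ⇒ ψ) = cong₂ _⇒_ (rename-cong ρ≗σ φ) (rename-cong ρ≗σ ψ)
rename-cong ρ≗σ (∀′ φ)  = cong ∀′_ (rename-cong (lift-cong ρ≗σ) φ)

lift-∘ : (σ : Fin m → Fin n) (ρ : Fin k → Fin m) →
         lift 1 σ ∘ lift 1 ρ ≗ lift 1 (σ ∘ ρ)
lift-∘ σ ρ zero    = refl
lift-∘ σ ρ (suc i) = refl

rename-∘ : (σ : Fin m → Fin n) (ρ : Fin k → Fin m) →
           rename σ ∘ rename ρ ≗ rename (σ ∘ ρ)
rename-∘ σ ρ (x ∈ y) = refl
rename-∘ σ ρ (x ≐ y) = refl
rename-∘ σ ρ ⊥       = refl
rename-∘ σ ρ (φ ⇒ ψ) = cong₂ _⇒_ (rename-∘ σ ρ φ) (rename-∘ σ ρ ψ)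
rename-∘ σ ρ (∀′ φ)  =
  cong ∀′_ (trans (rename-∘ (lift 1 σ) (lift 1 ρ) φ) (rename-cong (lift-∘ σ ρ) φ))

rename-square : ∀ {l} {σ : Fin m → Fin n} {ρ : Fin k → Fin m}
                {σ′ : Fin l → Fin n} {ρ′ : Fin k → Fin l} →
                σ ∘ ρ ≗ σ′ ∘ ρ′ → rename σ ∘ rename ρ ≗ rename σ′ ∘ rename ρ′
rename-square eq φ =
  trans (rename-∘ _ _ φ) (trans (rename-cong eq φ) (sym (rename-∘ _ _ φ)))

lift-instantiate : (ρ : Fin m → Fin n) (x : Fin m) →
                   ρ ∘ (x ◂ id) ≗ (ρ x ◂ id) ∘ lift 1 ρ
lift-instantiate ρ x zero    = refl
lift-instantiate ρ x (suc i) = refl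

rename-[] : (ρ : Fin m → Fin n) (φ : Formula (suc m)) (x : Fin m) →
            rename ρ (φ [ x ]) ≡ rename (lift 1 ρ) φ [ ρ x ]
rename-[] ρ φ x = rename-square (lift-instantiate ρ x) φ

lift-id : {ρ : Fin n → Fin n} → ρ ≗ id → lift 1 ρ ≗ id
lift-id ρ≗id zero    = refl
lift-id ρ≗id (suc i) = cong suc (ρ≗id i)

rename-id : {ρ : Fin n → Fin n} → ρ ≗ id → rename ρ ≗ id
rename-id ρ≗id (x ∈ y) = cong₂ _∈_ (ρ≗id x) (ρ≗id y)
rename-id ρ≗id (x ≐ y) = cong₂ _≐_ (ρ≗id x) (ρ≗id y)
rename-id ρ≗id ⊥       = refl
rename-id ρ≗id (φ ⇒ ψ) = cong₂ _⇒_ (rename-id ρ≗id φ) (rename-id ρ≗id ψ)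
rename-id ρ≗id (∀′ φ)  = cong ∀′_ (rename-id (lift-id ρ≗id) φ)

module _ {T : Theory} where

  map-lift-⊆ : {Γ : List (Formula m)} {Δ : List (Formula n)}
               (ρ : Fin m → Fin n) → map (rename ρ) Γ ⊆ᴸ Δ →
               map (rename (lift 1 ρ)) (map (rename suc) Γ) ⊆ᴸ map (rename suc) Δ
  map-lift-⊆ ρ sub p with ∈-map⁻ _ p
  ... | _ , q , refl with ∈-map⁻ _ q
  ... | ψ , r , refl =
    subst (_∈ᴸ _) (rename-square (λ _ → refl) ψ)
      (∈-map⁺ (rename suc) (sub (∈-map⁺ (rename ρ) r)))

  -- The target context is any superset of the renamed one, so that one induction yields both
  -- renaming and, through the identity renaming, weakening.
  rename-⊢ : {Γ : List (Formula m)} {Δ : List (Formula n)} {φ : Formula m}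
             (ρ : Fin m → Fin n) → map (rename ρ) Γ ⊆ᴸ Δ →
             T ∣ Γ ⊢ φ → T ∣ Δ ⊢ rename ρ φ
  rename-⊢ ρ sub (axiom {φ = φ} t)    =
    subst (T ∣ _ ⊢_) (trans (rename-cong (λ ()) φ) (sym (rename-∘ ρ (λ ()) φ))) (axiom t)
  rename-⊢ ρ sub (assume p)           = assume (sub (∈-map⁺ (rename ρ) p))
  rename-⊢ ρ sub (⇒-intro d)          = ⇒-intro (rename-⊢ ρ (∷⁺ʳ _ sub) d)
  rename-⊢ ρ sub (⇒-elim d e)         = ⇒-elim (rename-⊢ ρ sub d) (rename-⊢ ρ sub e)
  rename-⊢ ρ sub (by-contradiction d) = by-contradiction (rename-⊢ ρ (∷⁺ʳ _ sub) d)
  rename-⊢ ρ sub (∀-intro d)          = ∀-intro (rename-⊢ (lift 1 ρ) (map-lift-⊆ ρ sub) d)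
  rename-⊢ ρ sub (∀-elim {φ = φ} d x) =
    subst (T ∣ _ ⊢_) (sym (rename-[] ρ φ x)) (∀-elim (rename-⊢ ρ sub d) (ρ x))
  rename-⊢ ρ sub (≐-refl x)           = ≐-refl (ρ x)
  rename-⊢ ρ sub (≐-subst φ {x} {y} e d) =
    subst (T ∣ _ ⊢_) (sym (rename-[] ρ φ y))
      (≐-subst (rename (lift 1 ρ) φ) (rename-⊢ ρ sub e)
        (subst (T ∣ _ ⊢_) (rename-[] ρ φ x) (rename-⊢ ρ sub d)))

  map-rename-id-⊆ : {Γ Δ : List (Formula n)} → Γ ⊆ᴸ Δ → map (rename id) Γ ⊆ᴸ Δ
  map-rename-id-⊆ sub p with ∈-map⁻ _ p
  ... | φ , q , refl = subst (_∈ᴸ _) (sym (rename-id (λ _ → refl) φ)) (sub q)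

  weaken : {Γ Δ : List (Formula n)} {φ : Formula n} → Γ ⊆ᴸ Δ → T ∣ Γ ⊢ φ → T ∣ Δ ⊢ φ
  weaken {φ = φ} sub d =
    subst (T ∣ _ ⊢_) (rename-id (λ _ → refl) φ) (rename-⊢ id (map-rename-id-⊆ sub) d)

  cut : {Γ : List (Formula n)} {φ ψ : Formula n} →
        T ∣ Γ ⊢ φ → T ∣ φ ∷ Γ ⊢ ψ → T ∣ Γ ⊢ ψ
  cut d e = ⇒-elim (⇒-intro e) d

  hyp₀ : {Γ : List (Formula n)} {φ : Formula n} → T ∣ φ ∷ Γ ⊢ φ
  hyp₀ = assume (here refl)

  hyp₁ : {Γ : List (Formula n)} {φ ψ : Formula n} → T ∣ ψ ∷ φ ∷ Γ ⊢ φ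
  hyp₁ = assume (there (here refl))

  ex-falso : {Γ : List (Formula n)} {φ : Formula n} → T ∣ Γ ⊢ ⊥ → T ∣ Γ ⊢ φ
  ex-falso d = by-contradiction (weaken there d)

-- Completeness

-- Variables are the only terms, so over `n` variables there are finitely many formulas of depth at
-- most `d`, and a list holds them all.
formulas : ℕ → ∀ n → List (Formula n)
formulas zero    n = []
formulas (suc d) n =
  ⊥ ∷ cartesianProductWith _∈_ (allFin n) (allFin n)
   ++ cartesianProductWith _≐_ (allFin n) (allFin n)
   ++ cartesianProductWith _⇒_ (formulas d n) (formulas d n)
   ++ map ∀′_ (formulas d (suc n))

depth : Formula n → ℕ
depth (x ∈ y) = 1
depth (x ≐ y) = 1
depth ⊥       = 1
depth (φ ⇒ ψ) = suc (depth φ ⊔ depth ψ)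
depth (∀′ φ)  = suc (depth φ)

depth-rename : (ρ : Fin m → Fin n) (φ : Formula m) → depth (rename ρ φ) ≡ depth φ
depth-rename ρ (x ∈ y) = refl
depth-rename ρ (x ≐ y) = refl
depth-rename ρ ⊥       = refl
depth-rename ρ (φ ⇒ ψ) = cong₂ (λ a b → suc (a ⊔ b)) (depth-rename ρ φ) (depth-rename ρ ψ)
depth-rename ρ (∀′ φ)  = cong suc (depth-rename (lift 1 ρ) φ)

∈-formulas : ∀ {d} (φ : Formula n) → depth φ ≤ d → φ ∈ᴸ formulas d n
∈-formulas {n} {suc d} (x ∈ y) (s≤s p) =
  there (∈-++⁺ˡ (∈-cartesianProductWith⁺ _∈_ (∈-allFin x) (∈-allFin y)))
∈-formulas {n} {suc d} (x ≐ y) (s≤s p) =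
  there (∈-++⁺ʳ (cartesianProductWith _∈_ (allFin n) (allFin n))
    (∈-++⁺ˡ (∈-cartesianProductWith⁺ _≐_ (∈-allFin x) (∈-allFin y))))
∈-formulas {n} {suc d} ⊥ (s≤s p) = here refl
∈-formulas {n} {suc d} (φ ⇒ ψ) (s≤s p) =
  there (∈-++⁺ʳ (cartesianProductWith _∈_ (allFin n) (allFin n))
    (∈-++⁺ʳ (cartesianProductWith _≐_ (allFin n) (allFin n))
      (∈-++⁺ˡ (∈-cartesianProductWith⁺ _⇒_
        (∈-formulas φ (m⊔n≤o⇒m≤o _ _ p)) (∈-formulas ψ (m⊔n≤o⇒n≤o _ _ p))))))
∈-formulas {n} {suc d} (∀′ φ) (s≤s p) =
  there (∈-++⁺ʳ (cartesianProductWith _∈_ (allFin n) (allFin n))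
    (∈-++⁺ʳ (cartesianProductWith _≐_ (allFin n) (allFin n))
      (∈-++⁺ʳ (cartesianProductWith _⇒_ (formulas d n) (formulas d n))
        (∈-map⁺ ∀′_ (∈-formulas φ p)))))

-- Every stage introduces one variable and takes one formula off the queue, so
-- each formula over the variables of some stage is dealt with at a later one.
queue : ∀ n → List (Formula n)
queue zero    = []
queue (suc n) = map (rename suc) (drop 1 (queue n)) ++ formulas n (suc n)

first : List (Formula n) → Formula n
first []      = ⊥
first (φ ∷ _) = φ

task : ∀ n → Formula n
task n = first (queue n)

-- The de Bruijn level, which does not change when a variable is introduced and
-- thus identifies a variable across stages.
name : Fin n → ℕ
name i = toℕ (opposite i)

name-injective : {i j : Fin n} → name i ≡ name j → i ≡ j
name-injective {i = i} {j} eq =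
  trans (sym (opposite-involutive i))
    (trans (cong opposite (toℕ-injective eq)) (opposite-involutive j))

_NamedBy_ : (Fin n → Fin m) → (Fin n → ℕ) → Set
σ NamedBy ρ = ∀ i → name (σ i) ≡ ρ i

-- `carry` preserves names, so the formula met at the later stage speaks about the same variables.
record Scheduled (θ : Formula n) : Set where
  constructor scheduled
  field
    stage   : ℕ
    carry   : Fin n → Fin stage
    carried : carry NamedBy name
    isTask  : task stage ≡ rename carry θ

postpone : (θ : Formula n) → Scheduled (rename suc θ) → Scheduled θ
postpone θ (scheduled k τ named eq) =
  scheduled k (τ ∘ suc) (λ i → trans (named (suc i)) (opposite-suc i))
    (trans eq (rename-∘ τ suc θ))

-- Induction on the number `l` of formulas ahead of `θ`: each stage removes one of them and appends
-- only behind `θ`. The length is a separate argument because the list itself gives way to its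
-- renaming.
schedule-queued : ∀ l (xs ys : List (Formula n)) (θ : Formula n) →
                  length xs ≡ l → queue n ≡ xs ++ θ ∷ ys → Scheduled θ
schedule-queued {n} l [] ys θ _ eq =
  scheduled n id (λ _ → refl) (trans (cong first eq) (sym (rename-id (λ _ → refl) θ)))
schedule-queued {n} (suc l) (x ∷ xs) ys θ len eq =
  postpone θ (schedule-queued l (map (rename suc) xs)
    (map (rename suc) ys ++ formulas n (suc n)) (rename suc θ)
    (trans (length-map (rename suc) xs) (suc-injective len))
    (trans (cong (λ q → map (rename suc) (drop 1 q) ++ formulas n (suc n)) eq)
      (trans (cong (_++ formulas n (suc n)) (map-++ (rename suc) xs (θ ∷ ys)))
        (++-assoc (map (rename suc) xs) _ _))))

schedule-∈ : {θ : Formula n} → θ ∈ᴸ queue n → Scheduled θ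
schedule-∈ {θ = θ} p with ∈-∃++ p
... | xs , ys , eq = schedule-queued _ xs ys θ refl eq

-- Stage `suc n` enqueues the formulas of depth at most `n`. A deeper formula waits `l` stages: new
-- variables raise the bound and leave its depth alone.
schedule-deep : ∀ l (θ : Formula n) → depth θ ≤ l + n → Scheduled θ
schedule-deep {n} zero θ p =
  postpone θ (schedule-∈ (∈-++⁺ʳ (map (rename suc) (drop 1 (queue n)))
    (∈-formulas (rename suc θ) (subst (_≤ n) (sym (depth-rename suc θ)) p))))
schedule-deep {n} (suc l) θ p =
  postpone θ (schedule-deep l (rename suc θ)
    (subst (_≤ l + suc n) (sym (depth-rename suc θ)) (subst (depth θ ≤_) (sym (+-suc l n)) p)))

schedule : (θ : Formula n) → Scheduled θ
schedule θ = schedule-deep (depth θ) θ (m≤m+n (depth θ) _)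

-- Structures and truth in them

record Structure : Set₁ where
  infix 7 _ε_ _≈_
  field
    Carrier  : Set
    _ε_ _≈_  : Carrier → Carrier → Set
    Falsity  : Set
    ε-stable : ∀ {x y} → ((x ε y → Falsity) → Falsity) → x ε y
    ≈-stable : ∀ {x y} → ((x ≈ y → Falsity) → Falsity) → x ≈ y

  ⟦_⟧ : Formula n → (Fin n → Carrier) → Set
  ⟦ x ∈ y ⟧ ρ = ρ x ε ρ y
  ⟦ x ≐ y ⟧ ρ = ρ x ≈ ρ y
  ⟦ ⊥ ⟧     ρ = Falsity
  ⟦ φ ⇒ ψ ⟧ ρ = ⟦ φ ⟧ ρ → ⟦ ψ ⟧ ρ
  ⟦ ∀′ φ ⟧  ρ = ∀ x → ⟦ φ ⟧ (x ◂ ρ)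

_⊨_ : Structure → Sentence → Set
M ⊨ φ = Structure.⟦_⟧ M φ []ᶠ

-- The Henkin model

module Henkin {T : Theory} {ψ : Formula 1} (inhabited : T ⊢ ∃′ ψ) (φ₀ : Sentence) where

  infix 0 _⊩_

  _⊩_ : Pred (Formula n) 0ℓ → Formula n → Set
  Δ ⊩ φ = Σ (List _) λ Γ → All Δ Γ × (T ∣ Γ ⊢ φ)

  ⊩-assume : {Δ : Pred (Formula n) 0ℓ} {φ : Formula n} → Δ φ → Δ ⊩ φ
  ⊩-assume p = _ , p ∷ [] , hyp₀

  ⊩-mp : {Δ : Pred (Formula n) 0ℓ} {φ ψ : Formula n} → Δ ⊩ φ ⇒ ψ → Δ ⊩ φ → Δ ⊩ ψ
  ⊩-mp (Γ , p , d) (Γ′ , p′ , d′) =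
    Γ ++ Γ′ , All-++⁺ p p′ , ⇒-elim (weaken (xs⊆xs++ys Γ Γ′) d) (weaken (xs⊆ys++xs Γ′ Γ) d′)

  ⊩-map : {Δ : Pred (Formula n) 0ℓ} {φ ψ : Formula n} →
          (∀ {Γ} → T ∣ Γ ⊢ φ → T ∣ Γ ⊢ ψ) → Δ ⊩ φ → Δ ⊩ ψ
  ⊩-map f (Γ , p , d) = Γ , p , f d

  -- An inhabited universe is needed only here: for n = 0 there is no variable to
  -- substitute for the one dropped.
  drop-variable : {Γ : List (Formula n)} → T ∣ map (rename suc) Γ ⊢ ⊥ → T ∣ Γ ⊢ ⊥
  drop-variable d =
    ⇒-elim (rename-⊢ (λ ()) (λ ()) inhabited) (∀-intro (⇒-intro (weaken there d)))

  -- The Henkin axiom in universal form: the new variable is a counterexample to `φ` as soon as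
  -- there is one. Other formulas get a trivial axiom, which keeps the stages uniform.
  henkin : Formula n → Formula (suc n)
  henkin (∀′ φ) = φ ⇒ rename suc (∀′ φ)
  henkin _      = ⊥ ⇒ ⊥

  trivial-conservative : {Γ : List (Formula n)} →
                         T ∣ (⊥ ⇒ ⊥) ∷ map (rename suc) Γ ⊢ ⊥ → T ∣ Γ ⊢ ⊥
  trivial-conservative d = drop-variable (cut (⇒-intro hyp₀) d)

  -- If the axiom is refutable, then so is `∀′ φ`, while `φ` is provable for the new variable. The
  -- shifted context does not mention that variable, so generalising gives `∀′ φ`.
  henkin-conservative : {Γ : List (Formula n)} (θ : Formula n) →
                        T ∣ henkin θ ∷ map (rename suc) Γ ⊢ ⊥ → T ∣ Γ ⊢ ⊥
  henkin-conservative (x ∈ y) d = trivial-conservative d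
  henkin-conservative (x ≐ y) d = trivial-conservative d
  henkin-conservative ⊥       d = trivial-conservative d
  henkin-conservative (φ ⇒ χ) d = trivial-conservative d
  henkin-conservative {Γ = Γ} (∀′ φ) d =
    drop-variable (⇒-elim ¬∀ (rename-⊢ suc id (∀-intro example)))
    where
    example : T ∣ map (rename suc) Γ ⊢ φ
    example = by-contradiction (cut (⇒-intro (ex-falso (⇒-elim hyp₁ hyp₀)))
      (weaken (∷⁺ʳ _ there) d))
    ¬∀ : T ∣ map (rename suc) Γ ⊢ ¬ rename suc (∀′ φ)
    ¬∀ = ⇒-intro (cut (⇒-intro hyp₁) (weaken (∷⁺ʳ _ there) d))

  -- Whether θ is added need not be decided: a derivation from the extension that
  -- uses θ comes with evidence that θ may be added.
  data Extend (Δ : Pred (Formula n) 0ℓ) (θ : Formula n) : Pred (Formula (suc n)) 0ℓ where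
    kept    : ∀ {φ} → Δ φ → Extend Δ θ (rename suc φ)
    added   : (Δ ⊩ ¬ θ → T ⊢ φ₀) → Extend Δ θ (rename suc θ)
    witness : Extend Δ θ (henkin θ)

  -- A stage counts as consistent if deriving `⊥` from it yields `T ⊢ φ₀`. Starting from `¬ φ₀`
  -- ensures this at stage zero, by contradiction.
  Stage : ∀ n → Pred (Formula n) 0ℓ
  Stage zero    = _≡ ¬ φ₀
  Stage (suc n) = Extend (Stage n) (task n)

  module _ {Δ : Pred (Formula n) 0ℓ} {θ : Formula n} where

    -- Membership in `Extend` need not be decidable, but every hypothesis in use comes with its
    -- origin, so the list itself shows whether `θ` was added.
    trace : {Γ : List (Formula (suc n))} → All (Extend Δ θ) Γ →
            ∃[ Γ′ ] All Δ Γ′ ×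
              (Γ ⊆ᴸ henkin θ ∷ map (rename suc) Γ′
               ⊎ (Δ ⊩ ¬ θ → T ⊢ φ₀) × Γ ⊆ᴸ henkin θ ∷ map (rename suc) (θ ∷ Γ′))
    trace [] = [] , [] , inj₁ λ ()
    trace (e ∷ es) with trace es
    trace (kept {φ} p ∷ es) | Γ′ , ps , inj₁ sub = φ ∷ Γ′ , p ∷ ps , inj₁ λ where
      (here eq) → there (here eq)
      (there q) → ∷⁺ʳ _ there (sub q)
    trace (kept {φ} p ∷ es) | Γ′ , ps , inj₂ (c , sub) = φ ∷ Γ′ , p ∷ ps , inj₂ (c , λ where
      (here eq) → there (there (here eq))
      (there q) → ∷⁺ʳ _ (∷⁺ʳ _ there) (sub q))
    trace (added c ∷ es) | Γ′ , ps , inj₁ sub = Γ′ , ps , inj₂ (c , λ where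
      (here eq) → there (here eq)
      (there q) → ∷⁺ʳ _ there (sub q))
    trace (added c ∷ es) | Γ′ , ps , inj₂ (_ , sub) = Γ′ , ps , inj₂ (c , λ where
      (here eq) → there (here eq)
      (there q) → sub q)
    trace (witness ∷ es) | Γ′ , ps , inj₁ sub = Γ′ , ps , inj₁ λ where
      (here eq) → here eq
      (there q) → sub q
    trace (witness ∷ es) | Γ′ , ps , inj₂ (c , sub) = Γ′ , ps , inj₂ (c , λ where
      (here eq) → here eq
      (there q) → sub q)

    extend-conservative : (Δ ⊩ ⊥ → T ⊢ φ₀) → Extend Δ θ ⊩ ⊥ → T ⊢ φ₀
    extend-conservative bot (Γ , es , d) with trace es
    ... | Γ′ , ps , inj₁ sub       = bot (Γ′ , ps , henkin-conservative θ (weaken sub d))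
    ... | Γ′ , ps , inj₂ (c , sub) =
      c (Γ′ , ps , ⇒-intro (henkin-conservative θ (weaken sub d)))

  stage-conservative : ∀ n → Stage n ⊩ ⊥ → T ⊢ φ₀
  stage-conservative zero (Γ , ps , d) = by-contradiction (weaken (only ps) d)
    where
    only : {Γ : List Sentence} → All (_≡ ¬ φ₀) Γ → Γ ⊆ᴸ ¬ φ₀ ∷ []
    only (eq ∷ _)  (here refl) = here eq
    only (_  ∷ ps) (there q)   = only ps q
  stage-conservative (suc n) = extend-conservative (stage-conservative n)

  -- Valuations send variables to names. A formula under a valuation can be stated at stage `m` once
  -- that stage has variables with those names.
  HoldsAt : ℕ → Formula n → (Fin n → ℕ) → Set
  HoldsAt {n} m φ ρ = Σ (Fin n → Fin m) λ σ → σ NamedBy ρ × (Stage m ⊩ rename σ φ)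

  Holds : Formula n → (Fin n → ℕ) → Set
  Holds φ ρ = ∃[ m ] HoldsAt m φ ρ

  next-stage : {φ : Formula n} → Stage n ⊩ φ → Stage (suc n) ⊩ rename suc φ
  next-stage (Γ , ps , d) = map (rename suc) Γ , All-map⁺ (All-map kept ps) , rename-⊢ suc id d

  raise : {φ : Formula n} {ρ : Fin n → ℕ} → k ≤′ m → HoldsAt k φ ρ → HoldsAt m φ ρ
  raise (≤′-reflexive refl) h = h
  raise {φ = φ} (≤′-step p) h with raise p h
  ... | σ , named , d =
    suc ∘ σ , (λ i → trans (opposite-suc (σ i)) (named i)) ,
    subst (Stage _ ⊩_) (rename-∘ suc σ φ) (next-stage d)

  raise-⊔ˡ : {φ : Formula n} {ρ : Fin n → ℕ} → ∀ k m → HoldsAt k φ ρ → HoldsAt (k ⊔ m) φ ρ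
  raise-⊔ˡ k m = raise (≤⇒≤′ (m≤m⊔n k m))

  raise-⊔ʳ : {φ : Formula n} {ρ : Fin n → ℕ} → ∀ k m → HoldsAt m φ ρ → HoldsAt (k ⊔ m) φ ρ
  raise-⊔ʳ k m = raise (≤⇒≤′ (m≤n⊔m k m))

  -- At a given stage a name determines its variable, so any two renamings that realise `ρ` agree.
  reindex : {φ : Formula n} {ρ : Fin n → ℕ} {σ : Fin n → Fin m} →
            σ NamedBy ρ → HoldsAt m φ ρ → Stage m ⊩ rename σ φ
  reindex {φ = φ} named (σ′ , named′ , d) =
    subst (Stage _ ⊩_)
      (rename-cong (λ i → name-injective (trans (named′ i) (sym (named i)))) φ) d

  Holds-mp : {φ χ : Formula n} {ρ : Fin n → ℕ} → Holds (φ ⇒ χ) ρ → Holds φ ρ → Holds χ ρ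
  Holds-mp (k , h) (m , h′) with raise-⊔ˡ k m h
  ... | σ , named , d = k ⊔ m , σ , named , ⊩-mp d (reindex named (raise-⊔ʳ k m h′))

  Holds-⊥ : {ρ : Fin n → ℕ} → Holds ⊥ ρ → T ⊢ φ₀
  Holds-⊥ (m , _ , _ , d) = stage-conservative m d

  index : ∀ {x} → x < m → Fin m
  index x<m = opposite (fromℕ< x<m)

  name-index : ∀ {x} (x<m : x < m) → name (index x<m) ≡ x
  name-index x<m = trans (cong toℕ (opposite-involutive (fromℕ< x<m))) (toℕ-fromℕ< x<m)

  bound : (ρ : Fin n → ℕ) → ∃[ m ] (∀ i → ρ i < m)
  bound {zero}  ρ = 0 , λ ()
  bound {suc n} ρ with bound (ρ ∘ suc)
  ... | m , lt = suc (ρ zero) ⊔ m , λ where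
    zero    → m≤m⊔n (suc (ρ zero)) m
    (suc i) → <-≤-trans (lt i) (m≤n⊔m (suc (ρ zero)) m)

  locate : (ρ : Fin n → ℕ) → (∀ i → ρ i < m) → Σ (Fin n → Fin m) (_NamedBy ρ)
  locate ρ lt = (λ i → index (lt i)) , (λ i → name-index (lt i))

  record Processed (φ : Formula n) (ρ : Fin n → ℕ) : Set where
    constructor processed
    field
      stage  : ℕ
      σ      : Fin n → Fin stage
      named  : σ NamedBy ρ
      isTask : task stage ≡ rename σ φ

  process : (φ : Formula n) (ρ : Fin n → ℕ) → Processed φ ρ
  process φ ρ with bound ρ
  ... | m , lt with locate ρ lt
  ... | σ , named with schedule (rename σ φ)
  ... | scheduled k τ carried eq =
    processed k (τ ∘ σ) (λ i → trans (carried (σ i)) (named i)) (trans eq (rename-∘ τ σ φ))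

  -- The formula is the task of some stage `k`. A refutation of it from stage `k` is an instance of
  -- `Holds (¬ φ) ρ`, so the hypothesis is the evidence that `added` asks for.
  maximal : {φ : Formula n} {ρ : Fin n → ℕ} → (Holds (¬ φ) ρ → T ⊢ φ₀) → Holds φ ρ
  maximal {φ = φ} {ρ} consistent with process φ ρ
  ... | processed k σ named eq =
    suc k , suc ∘ σ , (λ i → trans (opposite-suc (σ i)) (named i)) ,
    subst (Stage (suc k) ⊩_) (trans (cong (rename suc) eq) (rename-∘ suc σ φ))
      (⊩-assume (added λ d → consistent (k , σ , named , subst (λ θ → Stage k ⊩ ¬ θ) eq d)))

  Holds-map : {φ χ : Formula n} {ρ : Fin n → ℕ} →
              (∀ {m} {σ : Fin n → Fin m} {Γ} → T ∣ Γ ⊢ rename σ φ → T ∣ Γ ⊢ rename σ χ) →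
              Holds φ ρ → Holds χ ρ
  Holds-map f (m , σ , named , d) = m , σ , named , ⊩-map f d

  Holds-stable : {φ : Formula n} {ρ : Fin n → ℕ} →
                 ((Holds φ ρ → T ⊢ φ₀) → T ⊢ φ₀) → Holds φ ρ
  Holds-stable ¬¬φ = maximal λ ¬φ → ¬¬φ λ φ → Holds-⊥ (Holds-mp ¬φ φ)

  -- The negated implication derives both `φ` and `¬ χ`, and the given function turns the former
  -- into `χ`.
  Holds-⇒ : {φ χ : Formula n} {ρ : Fin n → ℕ} → (Holds φ ρ → Holds χ ρ) → Holds (φ ⇒ χ) ρ
  Holds-⇒ f = maximal λ h → Holds-⊥ (Holds-mp
    (Holds-map (λ d → ⇒-intro (⇒-elim (weaken there d) (⇒-intro hyp₁))) h)
    (f (Holds-map (λ d → by-contradiction (⇒-elim (weaken there d)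
      (⇒-intro (ex-falso (⇒-elim hyp₁ hyp₀))))) h)))

  Holds-∀⁺ : {φ : Formula (suc n)} {ρ : Fin n → ℕ} → (∀ x → Holds φ (x ◂ ρ)) → Holds (∀′ φ) ρ
  Holds-∀⁺ {φ = φ} {ρ} f with process (∀′ φ) ρ
  -- The variable introduced after stage `k` has name `k` and carries the Henkin axiom for `∀′ φ`,
  -- so the premise is used at this one name.
  ... | processed k σ named eq = strengthen (Holds-mp implication (f k))
    where
    σ⁺ : Fin (suc _) → Fin (suc k)
    σ⁺ = zero ◂ (suc ∘ σ)
    implication : Holds (φ ⇒ rename suc (∀′ φ)) (k ◂ ρ)
    implication = suc k , σ⁺ ,
      (λ where
        zero    → toℕ-fromℕ k
        (suc i) → trans (opposite-suc (σ i)) (named i)) ,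
      subst (Stage (suc k) ⊩_)
        (trans (cong henkin eq)
          (cong₂ _⇒_ (rename-cong (λ { zero → refl ; (suc i) → refl }) φ)
            (rename-square (λ _ → refl) (∀′ φ))))
        (⊩-assume witness)
    strengthen : Holds (rename suc (∀′ φ)) (k ◂ ρ) → Holds (∀′ φ) ρ
    strengthen (m , τ , named′ , d) =
      m , τ ∘ suc , named′ ∘ suc , subst (Stage m ⊩_) (rename-∘ τ suc (∀′ φ)) d

  Holds-∀⁻ : {φ : Formula (suc n)} {ρ : Fin n → ℕ} → Holds (∀′ φ) ρ → ∀ x → Holds φ (x ◂ ρ)
  -- The name `x` exists from stage `suc x` on, which may lie beyond `m`.
  Holds-∀⁻ {φ = φ} {ρ} (m , h) x with raise-⊔ʳ (suc x) m h
  ... | σ , named , d =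
    suc x ⊔ m , i ◂ σ , (λ { zero → name-index x<m ; (suc j) → named j }) ,
    subst (Stage _ ⊩_)
      (trans (rename-∘ (i ◂ id) (lift 1 σ) φ) (rename-cong (λ { zero → refl ; (suc j) → refl }) φ))
      (⊩-map (λ e → ∀-elim e i) d)
    where
    x<m : x < suc x ⊔ m
    x<m = m≤m⊔n (suc x) m
    i : Fin (suc x ⊔ m)
    i = index x<m

  -- Off the range of `τ`, `ρ` may take names that do not exist yet at stage `m`; hence the passage
  -- to a stage beyond all of them.
  Holds-rename⁺ : {φ : Formula m} {ρ : Fin n → ℕ} (τ : Fin m → Fin n) →
                  Holds φ (ρ ∘ τ) → Holds (rename τ φ) ρ
  Holds-rename⁺ {φ = φ} {ρ} τ (m , h) with bound ρ
  ... | b , lt with locate ρ (λ i → <-≤-trans (lt i) (m≤n⊔m m b))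
  ... | σ , named = m ⊔ b , σ , named ,
    subst (Stage _ ⊩_) (sym (rename-∘ σ τ φ)) (reindex (named ∘ τ) (raise-⊔ˡ m b h))

  Holds-rename⁻ : {φ : Formula m} {ρ : Fin n → ℕ} (τ : Fin m → Fin n) →
                  Holds (rename τ φ) ρ → Holds φ (ρ ∘ τ)
  Holds-rename⁻ {φ = φ} τ (m , σ , named , d) =
    m , σ ∘ τ , named ∘ τ , subst (Stage m ⊩_) (rename-∘ σ τ φ) d

  Holds-cong : {φ : Formula n} {ρ ρ′ : Fin n → ℕ} → ρ ≗ ρ′ → Holds φ ρ → Holds φ ρ′
  Holds-cong eq (m , σ , named , d) = m , σ , (λ i → trans (named i) (eq i)) , d

  pair : ℕ → ℕ → Fin 2 → ℕ
  pair x y = x ◂ y ◂ []ᶠ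

  pair-∘ : (i j : Fin n) (ρ : Fin n → ℕ) → pair (ρ i) (ρ j) ≗ ρ ∘ (i ◂ j ◂ []ᶠ)
  pair-∘ i j ρ v0 = refl
  pair-∘ i j ρ v1 = refl

  -- The elements are the names of variables. Equality is a relation on them rather than identity,
  -- which saves a quotient.
  structure : Structure
  structure = record
    { Carrier  = ℕ
    ; _ε_      = λ x y → Holds (v0 ∈ v1) (pair x y)
    ; _≈_      = λ x y → Holds (v0 ≐ v1) (pair x y)
    ; Falsity  = T ⊢ φ₀
    ; ε-stable = Holds-stable
    ; ≈-stable = Holds-stable
    }

  open Structure structure using (⟦_⟧)

  -- The two directions go together because an implication uses the converse for its premise.
  truth⁺ : (φ : Formula n) (ρ : Fin n → ℕ) → Holds φ ρ → ⟦ φ ⟧ ρ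
  truth⁻ : (φ : Formula n) (ρ : Fin n → ℕ) → ⟦ φ ⟧ ρ → Holds φ ρ
  truth⁺ (i ∈ j) ρ h = Holds-cong (sym ∘ pair-∘ i j ρ) (Holds-rename⁻ {φ = v0 ∈ v1} (i ◂ j ◂ []ᶠ) h)
  truth⁺ (i ≐ j) ρ h = Holds-cong (sym ∘ pair-∘ i j ρ) (Holds-rename⁻ {φ = v0 ≐ v1} (i ◂ j ◂ []ᶠ) h)
  truth⁺ ⊥       ρ h = Holds-⊥ h
  truth⁺ (φ ⇒ χ) ρ h = λ p → truth⁺ χ ρ (Holds-mp h (truth⁻ φ ρ p))
  truth⁺ (∀′ φ)  ρ h = λ x → truth⁺ φ (x ◂ ρ) (Holds-∀⁻ h x)
  truth⁻ (i ∈ j) ρ h = Holds-rename⁺ (i ◂ j ◂ []ᶠ) (Holds-cong (pair-∘ i j ρ) h)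
  truth⁻ (i ≐ j) ρ h = Holds-rename⁺ (i ◂ j ◂ []ᶠ) (Holds-cong (pair-∘ i j ρ) h)
  truth⁻ ⊥       ρ h = Holds-stable λ _ → h
  truth⁻ (φ ⇒ χ) ρ h = Holds-⇒ (truth⁻ χ ρ ∘ h ∘ truth⁺ φ ρ)
  truth⁻ (∀′ φ)  ρ h = Holds-∀⁺ λ x → truth⁻ φ (x ◂ ρ) (h x)

  sound : ∀ {φ} → T ⊢ φ → structure ⊨ φ
  sound {φ} d = truth⁺ φ []ᶠ (0 , id , (λ ()) , [] , [] , rename-⊢ id (λ ()) d)

  -- Truth of `φ₀` clashes with `¬ φ₀`, the hypothesis of stage zero.
  proved : structure ⊨ φ₀ → T ⊢ φ₀
  proved h = Holds-⊥ {ρ = []ᶠ} (Holds-mp {φ = φ₀}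
    (0 , id , (λ ()) , ⊩-assume (cong ¬_ (rename-id (λ _ → refl) φ₀))) (truth⁻ φ₀ []ᶠ h))

completeness : ∀ {T ψ φ} → T ⊢ ∃′ ψ →
               (∀ M → (∀ {χ} → T ⊢ χ → M ⊨ χ) → M ⊨ φ) → T ⊢ φ
completeness {φ = φ} inhabited valid = proved (valid structure sound)
  where open Henkin inhabited φ

-- Set theory inside a model

pattern v4 = suc v3
pattern v5 = suc v4
pattern v6 = suc v5

module ClassicalLogic (M : Structure) where

  open Structure M

  record Stable (A : Set) : Set where
    constructor mkStable
    field stable : ((A → Falsity) → Falsity) → A

  open Stable {{...}} public

  instance
    stable-Falsity : Stable Falsity
    stable-Falsity = mkStable λ ¬¬f → ¬¬f id

    stable-ε : ∀ {x y} → Stable (x ε y)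
    stable-ε = mkStable ε-stable

    stable-≈ : ∀ {x y} → Stable (x ≈ y)
    stable-≈ = mkStable ≈-stable

    stable-Π : {A : Set} {B : A → Set} → {{∀ {x} → Stable (B x)}} → Stable (∀ x → B x)
    stable-Π = mkStable λ ¬¬f x → stable λ ¬b → ¬¬f λ f → ¬b (f x)

    stable-× : {A B : Set} → {{Stable A}} → {{Stable B}} → Stable (A × B)
    stable-× = mkStable λ ¬¬p →
      stable (λ ¬a → ¬¬p λ (a , _) → ¬a a) , stable (λ ¬b → ¬¬p λ (_ , b) → ¬b b)

  infixr 5 _∧ᶜ_
  infixr 4 _∨ᶜ_
  infix  2 _⇔ᶜ_

  -- These unfold to the interpretations of ∃′, ∧, ∨ and ⇔; a conjunction is
  -- a non-dependent existential.

  ∃ᶜ : {A : Set} → (A → Set) → Set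
  ∃ᶜ B = (∀ x → B x → Falsity) → Falsity

  _∧ᶜ_ _∨ᶜ_ _⇔ᶜ_ : Set → Set → Set
  A ∧ᶜ B = ∃ᶜ λ (_ : A) → B
  A ∨ᶜ B = (A → Falsity) → B
  A ⇔ᶜ B = (A → B) ∧ᶜ (B → A)

  -- An existential is double-negated, so its witness serves only a stable goal. Under this name,
  -- do-notation reads as taking a witness.
  _>>=_ : {A C : Set} {B : A → Set} → {{Stable C}} → ∃ᶜ B → (Σ A B → C) → C
  h >>= f = stable λ ¬c → h λ x b → ¬c (f (x , b))

  _&_ : {A : Set} {B : A → Set} (x : A) → B x → ∃ᶜ B
  (x & b) k = k x b

  infixr 4 _&_

  explode : {C : Set} → {{Stable C}} → Falsity → C
  explode f = stable λ _ → f

  fst : {A B : Set} → {{Stable A}} → A ∧ᶜ B → A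
  fst h = h >>= proj₁

  snd : {A B : Set} → {{Stable B}} → A ∧ᶜ B → B
  snd h = h >>= proj₂

  inl : {A B : Set} → {{Stable B}} → A → A ∨ᶜ B
  inl a ¬a = explode (¬a a)

  inr : {A B : Set} → B → A ∨ᶜ B
  inr b _ = b

  either : {A B C : Set} → {{Stable C}} → A ∨ᶜ B → (A → C) → (B → C) → C
  either h f g = stable λ ¬c → ¬c (g (h λ a → ¬c (f a)))

  to : {A B : Set} → {{Stable B}} → A ⇔ᶜ B → A → B
  to h = fst h

  from : {A B : Set} → {{Stable A}} → A ⇔ᶜ B → B → A
  from h = snd h

IsInductive : ∀ {n} → Fin n → Formula n
IsInductive J = (∃[∈ J ] Empty v0) ∧ (∀[∈ J ] ∃[∈ suc J ] IsSuccessor v0 v1)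

module SetTheory (M : Structure) (zf : ∀ {φ} → ZF ⊢ φ → M ⊨ φ) where

  open Structure M
  open ClassicalLogic M

  -- An instance of a schema takes its parameters from the highest index down.
  axm : ∀ {φ} → ZF φ → M ⊨ rename (λ ()) φ
  axm a = zf (axiom a)

  ≈-refl : ∀ {x} → x ≈ x
  ≈-refl {x} = zf (∀-intro (≐-refl v0)) x

  ≈-sym : ∀ {x y} → x ≈ y → y ≈ x
  ≈-sym {x} {y} = zf {∀′ ∀′ v1 ≐ v0 ⇒ v0 ≐ v1}
    (∀-intro (∀-intro (⇒-intro (≐-subst (v0 ≐ v2) hyp₀ (≐-refl v1))))) x y

  ≈-trans : ∀ {x y z} → x ≈ y → y ≈ z → x ≈ z
  ≈-trans {x} {y} {z} = zf {∀′ ∀′ ∀′ v2 ≐ v1 ⇒ v1 ≐ v0 ⇒ v2 ≐ v0}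
    (∀-intro (∀-intro (∀-intro (⇒-intro (⇒-intro (≐-subst (v3 ≐ v0) hyp₀ hyp₁)))))) x y z

  ε-congˡ : ∀ {x y z} → x ≈ y → x ε z → y ε z
  ε-congˡ {x} {y} {z} = zf {∀′ ∀′ ∀′ v2 ≐ v1 ⇒ v2 ∈ v0 ⇒ v1 ∈ v0}
    (∀-intro (∀-intro (∀-intro (⇒-intro (⇒-intro (≐-subst (v0 ∈ v1) hyp₁ hyp₀)))))) x y z

  ε-congʳ : ∀ {x y z} → x ≈ y → z ε x → z ε y
  ε-congʳ {x} {y} {z} = zf {∀′ ∀′ ∀′ v2 ≐ v1 ⇒ v0 ∈ v2 ⇒ v0 ∈ v1}
    (∀-intro (∀-intro (∀-intro (⇒-intro (⇒-intro (≐-subst (v1 ∈ v0) hyp₁ hyp₀)))))) x y z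

  _≈ᵉ_ : ∀ {n} → (Fin n → Carrier) → (Fin n → Carrier) → Set
  ρ ≈ᵉ ρ′ = ∀ i → ρ i ≈ ρ′ i

  -- `≈` is a mere relation on the carrier, so Agda cannot rewrite along it; predicates that
  -- interpret a formula get substitution from this induction.
  ⟦⟧-cong : ∀ {n} (φ : Formula n) {ρ ρ′} → ρ ≈ᵉ ρ′ → ⟦ φ ⟧ ρ → ⟦ φ ⟧ ρ′
  ⟦⟧-cong (x ∈ y) e h = ε-congʳ (e y) (ε-congˡ (e x) h)
  ⟦⟧-cong (x ≐ y) e h = ≈-trans (≈-sym (e x)) (≈-trans h (e y))
  ⟦⟧-cong ⊥       e h = h
  ⟦⟧-cong (φ ⇒ ψ) e h = λ p → ⟦⟧-cong ψ e (h (⟦⟧-cong φ (λ i → ≈-sym (e i)) p))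
  ⟦⟧-cong (∀′ φ)  e h = λ x → ⟦⟧-cong φ (λ { zero → ≈-refl ; (suc i) → e i }) (h x)

  replace : ∀ {n} (φ : Formula (suc n)) (ρ : Fin n → Carrier) {x y} →
            x ≈ y → ⟦ φ ⟧ (x ◂ ρ) → ⟦ φ ⟧ (y ◂ ρ)
  replace φ ρ e = ⟦⟧-cong φ λ { zero → e ; (suc i) → ≈-refl }

  _⊑_ : Carrier → Carrier → Set
  x ⊑ y = ∀ z → z ε x → z ε y

  ext : ∀ {x y} → x ⊑ y → y ⊑ x → x ≈ y
  ext {x} {y} x⊑y y⊑x = axm extensionality-ax x y λ z → x⊑y z & y⊑x z

  ext⇔ : ∀ {x y} {A : Carrier → Set} → {{∀ {z} → Stable (A z)}} →
         (∀ z → z ε x ⇔ᶜ A z) → (∀ z → z ε y ⇔ᶜ A z) → x ≈ y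
  ext⇔ hx hy = ext (λ z z∈x → from (hy z) (to (hx z) z∈x)) (λ z z∈y → from (hx z) (to (hy z) z∈y))

  -- This and most predicates below unfold to interpretations of formulas, so instances of the
  -- axioms apply to them without translation.
  Union : Carrier → Carrier → Set
  Union u x = ∀ z → z ε u ⇔ᶜ (∃ᶜ λ y → y ε x ∧ᶜ z ε y)

  union-exists : ∀ x → ∃ᶜ λ u → Union u x
  union-exists = axm union-ax

  power-exists : ∀ x → ∃ᶜ λ p → ∀ z → z ε p ⇔ᶜ z ⊑ x
  power-exists = axm powerSet-ax

  -- Foundation for the singleton of `x`: its one element `x` would be disjoint from it, yet `x ε x`
  -- puts `x` in both.
  ∉-self : ∀ {x} → x ε x → Falsity
  ∉-self {x} x∈x = do
    (a , a≡) ← axm pairing-ax x x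
    (y , h) ← axm foundation-ax a (x & from (a≡ x) (inl ≈-refl))
    (y∈a , disjoint) ← h
    let y≈x = either (to (a≡ y) y∈a) id id
    disjoint (x & (ε-congʳ (≈-sym y≈x) x∈x & from (a≡ x) (inl ≈-refl)))

  UnorderedPair : Carrier → Carrier → Carrier → Set
  UnorderedPair z x y = ∀ w → w ε z ⇔ᶜ (w ≈ x ∨ᶜ w ≈ y)

  Pair : Carrier → Carrier → Carrier → Set
  Pair p x y = ∀ z → z ε p ⇔ᶜ (UnorderedPair z x x ∨ᶜ UnorderedPair z x y)

  Pair-replace : ∀ {p q x x′ y y′} → p ≈ q → x ≈ x′ → y ≈ y′ → Pair p x y → Pair q x′ y′
  Pair-replace {p} {q} {x} {x′} {y} {y′} e e₁ e₂ =
    ⟦⟧-cong (IsPair v0 v1 v2) {p ◂ x ◂ y ◂ []ᶠ} {q ◂ x′ ◂ y′ ◂ []ᶠ}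
      λ { v0 → e ; v1 → e₁ ; v2 → e₂ }

  pairing-exists : ∀ x y → ∃ᶜ λ z → UnorderedPair z x y
  pairing-exists = axm pairing-ax

  Pair-exists : ∀ x y → ∃ᶜ λ p → Pair p x y
  Pair-exists x y = do
    (a , a≡) ← pairing-exists x x
    (b , b≡) ← pairing-exists x y
    (p , p≡) ← pairing-exists a b
    p & λ z →
      (λ z∈p → either (to (p≡ z) z∈p)
        (λ z≈a → inl λ w → (λ w∈z → to (a≡ w) (ε-congʳ z≈a w∈z))
          & λ h → ε-congʳ (≈-sym z≈a) (from (a≡ w) h))
        (λ z≈b → inr λ w → (λ w∈z → to (b≡ w) (ε-congʳ z≈b w∈z))
          & λ h → ε-congʳ (≈-sym z≈b) (from (b≡ w) h)))
      & λ h → either h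
        (λ z≡ → from (p≡ z) (inl (ext⇔ z≡ a≡)))
        (λ z≡ → from (p≡ z) (inr (ext⇔ z≡ b≡)))

  -- The singleton of `x` belongs to the pair, so it is the singleton of `u` or the set of `u` and
  -- `v`; either way it contains `u`.
  Pair-fst : ∀ {p x y u v} → Pair p x y → Pair p u v → x ≈ u
  Pair-fst {x = x} {u = u} hp hq = do
    (a , a≡) ← pairing-exists x x
    let a∈p = from (hp a) (inl a≡)
        u∈a = either (to (hq a) a∈p) (λ h → from (h u) (inl ≈-refl)) (λ h → from (h u) (inl ≈-refl))
    ≈-sym (either (to (a≡ u) u∈a) id id)

  Pair-snd′ : ∀ {p x y u v} → Pair p x y → Pair p u v → y ≈ u ∨ᶜ y ≈ v
  Pair-snd′ {x = x} {y} hp hq = do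
    (b , b≡) ← pairing-exists x y
    let y∈b = from (b≡ y) (inr ≈-refl)
    either (to (hq b) (from (hp b) (inr b≡)))
      (λ h → inl (either (to (h y) y∈b) id id))
      (λ h → to (h y) y∈b)

  -- `Pair-snd′` is used both ways round. If it yields only `y ≈ u` and `v ≈ x`, all four entries
  -- coincide.
  Pair-snd : ∀ {p x y u v} → Pair p x y → Pair p u v → y ≈ v
  Pair-snd hp hq = either (Pair-snd′ hp hq)
    (λ y≈u → either (Pair-snd′ hq hp)
      (λ v≈x → ≈-trans y≈u (≈-trans (≈-sym (Pair-fst hp hq)) (≈-sym v≈x)))
      ≈-sym)
    id

  -- Natural numbers

  Void : Carrier → Set
  Void x = ∀ y → y ε x → Falsity

  Successor : Carrier → Carrier → Set
  Successor s n = ∀ z → z ε s ⇔ᶜ (z ε n ∨ᶜ z ≈ n)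

  Inductive : Carrier → Set
  Inductive J = (∃ᶜ λ e → e ε J ∧ᶜ Void e) ∧ᶜ (∀ n → n ε J → ∃ᶜ λ s → s ε J ∧ᶜ Successor s n)

  Successor-cong : ∀ {s n m} → n ≈ m → Successor s n → Successor s m
  Successor-cong {s} e = replace (IsSuccessor v1 v0) (s ◂ []ᶠ) e

  ∈-successor : ∀ {s n m} → Successor s n → m ε n ∨ᶜ m ≈ n → m ε s
  ∈-successor {m = m} s≡ = from (s≡ m)

  Omega : Carrier → Set
  Omega w = Inductive w × (∀ J → Inductive J → w ⊑ J)

  -- The intersection of all inductive sets, cut out of one of them. It is inductive because the
  -- empty sets and the successors found in different inductive sets are equal by extensionality.
  omega-exists : ∃ᶜ Omega
  omega-exists = do
    (I , I-inductive) ← axm infinity-ax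
    (w , w≡) ← axm (separation-ax 0 (∀′ IsInductive v0 ⇒ v1 ∈ v0)) I
    let least : ∀ J → Inductive J → w ⊑ J
        least J J-inductive n n∈w = snd (to (w≡ n) n∈w) J J-inductive
        zero∈ : ∃ᶜ λ e → e ε w ∧ᶜ Void e
        zero∈ = do
          (e , h) ← fst I-inductive
          (e∈I , void) ← h
          e & from (w≡ e) (e∈I & λ J J-inductive → do
                (e′ , h′) ← fst J-inductive
                (e′∈J , void′) ← h′
                ε-congˡ (ext (λ z z∈ → explode (void′ z z∈)) (λ z z∈ → explode (void z z∈))) e′∈J)
            & void
        suc∈ : ∀ n → n ε w → ∃ᶜ λ s → s ε w ∧ᶜ Successor s n
        suc∈ n n∈w = do
          (s , h) ← snd I-inductive n (fst (to (w≡ n) n∈w))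
          (s∈I , s≡) ← h
          s & from (w≡ s) (s∈I & λ J J-inductive → do
                (s′ , h′) ← snd J-inductive n (least J J-inductive n n∈w)
                (s′∈J , s′≡) ← h′
                ε-congˡ (ext⇔ s′≡ s≡) s′∈J)
            & s≡
    w & (zero∈ & suc∈) , least

  module Naturals {w : Carrier} (omega : Omega w) where

    zero-exists : ∃ᶜ λ e → e ε w ∧ᶜ Void e
    zero-exists = fst (proj₁ omega)

    suc-exists : ∀ n → n ε w → ∃ᶜ λ s → s ε w ∧ᶜ Successor s n
    suc-exists = snd (proj₁ omega)

    -- `Φ` is an Agda predicate, whereas only formulas carve out sets; `separated` is supplied by
    -- separation at each use. The set it gives is inductive and so contains `w`.
    induction : {Φ : Carrier → Set} → {{∀ {x} → Stable (Φ x)}} →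
                (∃ᶜ λ b → ∀ x → x ε b ⇔ᶜ (x ε w ∧ᶜ Φ x)) →
                (∀ e → Void e → Φ e) →
                (∀ n s → n ε w → s ε w → Successor s n → Φ n → Φ s) →
                ∀ n → n ε w → Φ n
    induction separated base step n n∈w = do
      (b , b≡) ← separated
      let zero∈ = do
            (e , h) ← zero-exists
            (e∈w , void) ← h
            e & from (b≡ e) (e∈w & base e void) & void
          suc∈ = λ m m∈b → do
            (m∈w , Φm) ← to (b≡ m) m∈b
            (s , h) ← suc-exists m m∈w
            (s∈w , s≡) ← h
            s & from (b≡ s) (s∈w & step m s m∈w s∈w s≡ Φm) & s≡
      snd (to (b≡ n) (proj₂ omega b (zero∈ & suc∈) n n∈w))

    transitive : ∀ n → n ε w → ∀ m → m ε n → m ⊑ n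
    transitive = induction (axm (separation-ax 0 (∀[∈ v0 ] v0 ⊆ v1)) w)
      (λ e void m m∈e → explode (void m m∈e))
      (λ n s _ _ s≡ ih m m∈s k k∈m → ∈-successor s≡ (inl (either (to (s≡ m) m∈s)
        (λ m∈n → ih m m∈n k k∈m) (λ m≈n → ε-congʳ m≈n k∈m))))

    zero-least : ∀ n → n ε w → ∀ e → Void e → e ε n ∨ᶜ e ≈ n
    zero-least = induction (axm (separation-ax 0 (∀′ Empty v0 ⇒ v0 ∈ v1 ∨ v0 ≐ v1)) w)
      (λ n void e void′ →
        inr (ext (λ z z∈e → explode (void′ z z∈e)) (λ z z∈n → explode (void z z∈n))))
      (λ n s _ _ s≡ ih e void → inl (∈-successor s≡ (ih e void)))

    suc-least : ∀ n → n ε w → ∀ m → m ε n → ∀ s → Successor s m → s ε n ∨ᶜ s ≈ n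
    suc-least = induction
      (axm (separation-ax 0 (∀[∈ v0 ] ∀′ IsSuccessor v0 v1 ⇒ v0 ∈ v2 ∨ v0 ≐ v2)) w)
      (λ e void m m∈e → explode (void m m∈e))
      (λ n t _ _ t≡ ih m m∈t s s≡ → either (to (t≡ m) m∈t)
        (λ m∈n → inl (∈-successor t≡ (ih m m∈n s s≡)))
        (λ m≈n → inr (ext⇔ s≡ (Successor-cong (≈-sym m≈n) t≡))))

    -- Induction on `n`: if `k` is above `m` and `n`, then the successor of `k` is above `m` and the
    -- successor of `n`, since `suc-least` puts the latter at most at `k`.
    directed : ∀ n → n ε w → ∀ m → m ε w → ∃ᶜ λ k → k ε w ∧ᶜ m ε k ∧ᶜ n ε k
    directed = induction
      (axm (separation-ax 0 (∀[∈ v1 ] ∃[∈ v2 ] v1 ∈ v0 ∧ v2 ∈ v0)) w)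
      (λ e void m m∈w → do
        (k , h) ← suc-exists m m∈w
        (k∈w , k≡) ← h
        k & k∈w & ∈-successor k≡ (inr ≈-refl) & ∈-successor k≡ (zero-least m m∈w e void))
      (λ n s _ _ s≡ ih m m∈w → do
        (k , h) ← ih m m∈w
        (k∈w , h₁) ← h
        (m∈k , n∈k) ← h₁
        (l , h₂) ← suc-exists k k∈w
        (l∈w , l≡) ← h₂
        l & l∈w & ∈-successor l≡ (inl m∈k) & ∈-successor l≡ (suc-least k k∈w n n∈k s s≡))

  -- Cartesian products and relations

  Product : Carrier → Carrier → Carrier → Set
  Product c a b = ∀ p → p ε c ⇔ᶜ (∃ᶜ λ x → x ε a ∧ᶜ (∃ᶜ λ y → y ε b ∧ᶜ Pair p x y))

  -- A Kuratowski pair with entries in the union `u` of `a` and `b` is a set of subsets of `u`,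
  -- hence lies in the second power set `qq`.
  product-exists : ∀ a b → ∃ᶜ λ c → Product c a b
  product-exists a b = do
    (d , d≡) ← pairing-exists a b
    (u , u≡) ← union-exists d
    (q , q≡) ← power-exists u
    (qq , qq≡) ← power-exists q
    (c , c≡) ← axm (separation-ax 2 (∃[∈ v3 ] ∃[∈ v3 ] IsPair v2 v1 v0)) a b qq
    c & λ p → (λ p∈c → snd (to (c≡ p) p∈c)) & λ h → from (c≡ p) (from (qq≡ p) (λ z z∈p → do
        (x , h₁) ← h
        (x∈a , h₂) ← h₁
        (y , h₃) ← h₂
        (y∈b , p≡) ← h₃
        let x∈u = from (u≡ x) (a & from (d≡ a) (inl ≈-refl) & x∈a)
            y∈u = from (u≡ y) (b & from (d≡ b) (inr ≈-refl) & y∈b)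
        from (q≡ z) λ t t∈z → either (to (p≡ z) z∈p)
          (λ z≡ → either (to (z≡ t) t∈z)
            (λ e → ε-congˡ (≈-sym e) x∈u)
            (λ e → ε-congˡ (≈-sym e) x∈u))
          (λ z≡ → either (to (z≡ t) t∈z)
            (λ e → ε-congˡ (≈-sym e) x∈u)
            (λ e → ε-congˡ (≈-sym e) y∈u)))
      & h)

  Related : Carrier → Carrier → Carrier → Set
  Related x y r = ∃ᶜ λ p → p ε r ∧ᶜ Pair p x y

  CompatibleIn : Carrier → Carrier → Carrier → Carrier → Set
  CompatibleIn P R p q = ∃ᶜ λ r → r ε P ∧ᶜ Related r p R ∧ᶜ Related r q R

-- From maximal antichains to choice

HasCode : ∀ {n} → Fin n → Fin n → Fin n → Fin n → Formula n
HasCode p X x k = ∃′ IsPair v0 (suc X) (suc x) ∧ IsPair (suc p) v0 (suc k)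

-- From `v4` down to `v0` the bound variables are X, x, y, n, m, with `p` the triple (X , x , n) and
-- `q` the triple (X , y , m).
IsBelow : ∀ {n} → Fin n → Fin n → Formula n
IsBelow p q = ∃′ ∃′ ∃′ ∃′ ∃′
  HasCode p′ v4 v3 v1 ∧ HasCode q′ v4 v2 v0 ∧ (p′ ≐ q′ ∨ v0 ∈ v1)
  where
  p′ = suc (suc (suc (suc (suc p))))
  q′ = suc (suc (suc (suc (suc q))))

module AntichainToChoice (M : Structure) (zf : ∀ {φ} → ZF ⊢ φ → M ⊨ φ) where

  open Structure M
  open ClassicalLogic M
  open SetTheory M zf

  Code : Carrier → Carrier → Carrier → Carrier → Set
  Code p X x n = ∃ᶜ λ g → Pair g X x ∧ᶜ Pair p g n

  Code-replace : ∀ {p X X′ x n} → X ≈ X′ → Code p X x n → Code p X′ x n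
  Code-replace {p} {x = x} {n} = replace (HasCode v1 v0 v2 v3) (p ◂ x ◂ n ◂ []ᶠ)

  Code-injective : ∀ {p q X Y x y n m} → p ≈ q → Code p X x n → Code q Y y m →
                   X ≈ Y × x ≈ y × n ≈ m
  Code-injective p≈q hp hq = do
    (g , h) ← hp
    (g≡ , p≡) ← h
    (g′ , h′) ← hq
    (g′≡ , q≡) ← h′
    let p≡′ = Pair-replace p≈q ≈-refl ≈-refl p≡
        g≡′ = Pair-replace (Pair-fst p≡′ q≡) ≈-refl ≈-refl g≡
    Pair-fst g≡′ g′≡ , Pair-snd g≡′ g′≡ , Pair-snd p≡′ q≡

  Below : Carrier → Carrier → Set
  Below p q = ∃ᶜ λ X → ∃ᶜ λ x → ∃ᶜ λ y → ∃ᶜ λ n → ∃ᶜ λ m →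
    Code p X x n ∧ᶜ Code q X y m ∧ᶜ (p ≈ q ∨ᶜ m ε n)

  -- Gathers the layers of existentials, so that a single bind opens them all.
  Below-view : ∀ {p q} → Below p q → ∃ᶜ λ X → Σ[ x ∈ Carrier ] Σ[ y ∈ Carrier ]
               Σ[ n ∈ Carrier ] Σ[ m ∈ Carrier ] Code p X x n × Code q X y m × (p ≈ q ∨ᶜ m ε n)
  Below-view h = do
    (X , h₁) ← h
    (x , h₂) ← h₁
    (y , h₃) ← h₂
    (n , h₄) ← h₃
    (m , h₅) ← h₄
    (p≡ , h₆) ← h₅
    (q≡ , alt) ← h₆
    X & x , y , n , m , p≡ , q≡ , alt

  Below-replace : ∀ {p p′ q q′} → p ≈ p′ → q ≈ q′ → Below p q → Below p′ q′
  Below-replace {p} {p′} {q} {q′} e e′ =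
    ⟦⟧-cong (IsBelow v0 v1) {p ◂ q ◂ []ᶠ} {p′ ◂ q′ ◂ []ᶠ} λ { v0 → e ; v1 → e′ }

  -- The order on triples

  module Fibers {F w G P PP R : Carrier} (omega : Omega w)
    (G≡ : ∀ g → g ε G ⇔ᶜ (∃ᶜ λ X → X ε F ∧ᶜ (∃ᶜ λ x → x ε X ∧ᶜ Pair g X x)))
    (P≡ : Product P G w) (PP≡ : Product PP P P)
    (R≡ : ∀ r → r ε R ⇔ᶜ (r ε PP ∧ᶜ (∃ᶜ λ p → ∃ᶜ λ q → Pair r p q ∧ᶜ Below p q))) where

    open Naturals omega

    code-exists : ∀ {X x n} → X ε F → x ε X → n ε w → ∃ᶜ λ p → p ε P ∧ᶜ Code p X x n
    code-exists {X} {x} {n} X∈F x∈X n∈w = do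
      (g , g≡) ← Pair-exists X x
      (p , p≡) ← Pair-exists g n
      p & from (P≡ p) (g & from (G≡ g) (X & X∈F & x & x∈X & g≡) & n & n∈w & p≡) & g & g≡ & p≡

    P-view : ∀ {p} → p ε P → ∃ᶜ λ X → Σ[ x ∈ Carrier ] Σ[ n ∈ Carrier ]
             X ε F × x ε X × n ε w × Code p X x n
    P-view {p} p∈P = do
      (g , h) ← to (P≡ p) p∈P
      (g∈G , h₁) ← h
      (n , h₂) ← h₁
      (n∈w , p≡) ← h₂
      (X , h₃) ← to (G≡ g) g∈G
      (X∈F , h₄) ← h₃
      (x , h₅) ← h₄
      (x∈X , g≡) ← h₅
      X & x , n , X∈F , x∈X , n∈w , g & g≡ & p≡

    components : ∀ {p X x n} → p ε P → Code p X x n → X ε F × x ε X × n ε w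
    components p∈P p≡ = do
      (X , x , n , X∈F , x∈X , n∈w , p≡′) ← P-view p∈P
      let X≈ , x≈ , n≈ = Code-injective ≈-refl p≡′ p≡
      ε-congˡ X≈ X∈F , ε-congʳ X≈ (ε-congˡ x≈ x∈X) , ε-congˡ n≈ n∈w

    R-intro : ∀ {p q} → p ε P → q ε P → Below p q → Related p q R
    R-intro {p} {q} p∈P q∈P below = do
      (r , r≡) ← Pair-exists p q
      r & from (R≡ r) (from (PP≡ r) (p & p∈P & q & q∈P & r≡) & p & q & r≡ & below) & r≡

    R-elim : ∀ {p q} → Related p q R → Below p q
    R-elim h = do
      (r , h₁) ← h
      (r∈R , r≡) ← h₁
      (p , h₂) ← snd (to (R≡ r) r∈R)
      (q , h₃) ← h₂
      (r≡′ , below) ← h₃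
      Below-replace (Pair-fst r≡′ r≡) (Pair-snd r≡′ r≡) below

    relation-on : ∀ r → r ε R → ∃ᶜ λ p → p ε P ∧ᶜ (∃ᶜ λ q → q ε P ∧ᶜ Pair r p q)
    relation-on r r∈R = to (PP≡ r) (fst (to (R≡ r) r∈R))

    reflexive : ∀ p → p ε P → Related p p R
    reflexive p p∈P = do
      (X , x , n , _ , _ , _ , p≡) ← P-view p∈P
      R-intro p∈P p∈P (X & x & x & n & n & p≡ & p≡ & inl ≈-refl)

    antisymmetric : ∀ p → p ε P → ∀ q → q ε P → Related p q R ∧ᶜ Related q p R → p ≈ q
    antisymmetric p p∈P q q∈P h = do
      (pRq , qRp) ← h
      (X , x , y , n , m , p≡ , q≡ , alt) ← Below-view (R-elim pRq)
      (X′ , y′ , x′ , m′ , n′ , q≡′ , p≡′ , alt′) ← Below-view (R-elim qRp)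
      -- Were neither comparison an equality, `m` and `n` would be members of each other, and
      -- transitivity of `n` would give `n ε n`.
      either alt id λ m∈n → either alt′ ≈-sym λ n′∈m′ →
        let _ , _ , n∈w   = components p∈P p≡
            _ , _ , n≈n′ = Code-injective ≈-refl p≡ p≡′
            _ , _ , m≈m′ = Code-injective ≈-refl q≡ q≡′
            n∈m = ε-congʳ (≈-sym m≈m′) (ε-congˡ (≈-sym n≈n′) n′∈m′)
        in explode (∉-self (transitive n n∈w m m∈n n n∈m))

    R-transitive : ∀ p → p ε P → ∀ q → q ε P → ∀ r → r ε P →
                   Related p q R ∧ᶜ Related q r R → Related p r R
    R-transitive p p∈P q q∈P r r∈P h = do
      (pRq , qRr) ← h
      (X , x , y , n , m , p≡ , q≡ , alt) ← Below-view (R-elim pRq)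
      (X′ , y′ , z , m′ , l , q≡′ , r≡ , alt′) ← Below-view (R-elim qRr)
      let _ , _ , n∈w       = components p∈P p≡
          X≈X′ , _ , m≈m′ = Code-injective ≈-refl q≡ q≡′
      R-intro p∈P r∈P (X & x & z & n & l & p≡ & Code-replace (≈-sym X≈X′) r≡ &
        either alt
          (λ p≈q → either alt′
            (λ q≈r → inl (≈-trans p≈q q≈r))
            (λ l∈m′ → inr (ε-congʳ (≈-sym (proj₂ (proj₂ (Code-injective p≈q p≡ q≡′)))) l∈m′)))
          (λ m∈n → inr (either alt′
            (λ q≈r → ε-congˡ (proj₂ (proj₂ (Code-injective q≈r q≡ r≡))) m∈n)
            (λ l∈m′ → transitive n n∈w m m∈n l (ε-congʳ (≈-sym m≈m′) l∈m′)))))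

    partial-order : ⟦ IsPartialOrder v0 v1 ⟧ (P ◂ R ◂ []ᶠ)
    partial-order = relation-on & reflexive & antisymmetric & R-transitive

    -- This is the purpose of the third component: for `k` above `n` and `m`, the triple of `X`, `x`
    -- and `k` lies below both, as a strict comparison ignores second components.
    fiber-compatible : ∀ {p q X x y n m} → p ε P → q ε P → Code p X x n → Code q X y m →
                       CompatibleIn P R p q
    fiber-compatible {p} {q} {X} {x} {y} {n} {m} p∈P q∈P p≡ q≡ = do
      let X∈F , x∈X , n∈w = components p∈P p≡
          _ , _ , m∈w     = components q∈P q≡
      (k , h) ← directed n n∈w m m∈w
      (k∈w , h₁) ← h
      (m∈k , n∈k) ← h₁
      (r , h₂) ← code-exists X∈F x∈X k∈w
      (r∈P , r≡) ← h₂
      r & r∈P & R-intro r∈P p∈P (X & x & x & k & n & r≡ & p≡ & inr n∈k)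
              & R-intro r∈P q∈P (X & x & y & k & m & r≡ & q≡ & inr m∈k)

    -- A common lower bound shares its first component with each triple above it.
    compatible-fiber : ∀ {p q X Y x y n m} → CompatibleIn P R p q →
                       Code p X x n → Code q Y y m → X ≈ Y
    compatible-fiber h p≡ q≡ = do
      (r , h₁) ← h
      (r∈P , h₂) ← h₁
      (rRp , rRq) ← h₂
      (_ , _ , _ , _ , _ , r≡ , p≡′ , _) ← Below-view (R-elim rRp)
      (_ , _ , _ , _ , _ , r≡′ , q≡′ , _) ← Below-view (R-elim rRq)
      ≈-trans (proj₁ (Code-injective ≈-refl p≡ p≡′))
        (≈-trans (proj₁ (Code-injective ≈-refl r≡ r≡′)) (proj₁ (Code-injective ≈-refl q≡′ q≡)))

    -- The choice function of a maximal antichain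

    module Choose {A f : Carrier} (nonempty : ∀ X → X ε F → ∃ᶜ λ x → x ε X)
      (A⊆P : A ⊑ P)
      (antichain : ∀ p → p ε A → ∀ q → q ε A → (p ≈ q → Falsity) → CompatibleIn P R p q → Falsity)
      (maximal : ∀ p → p ε P → ∃ᶜ λ q → q ε A ∧ᶜ CompatibleIn P R p q)
      (f≡ : ∀ g → g ε f ⇔ᶜ (g ε G ∧ᶜ (∃ᶜ λ n → ∃ᶜ λ p → p ε A ∧ᶜ Pair p g n))) where

      f-intro : ∀ {p X x n} → p ε A → Code p X x n → Related X x f
      f-intro {p} {n = n} p∈A p≡ = do
        (g , h) ← p≡
        (g≡ , p≡g) ← h
        (g′ , h₁) ← to (P≡ p) (A⊆P p p∈A)
        (g′∈G , h₂) ← h₁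
        (_ , h₃) ← h₂
        (_ , p≡g′) ← h₃
        g & from (f≡ g) (ε-congˡ (Pair-fst p≡g′ p≡g) g′∈G & n & p & p∈A & p≡g) & g≡

      f-elim : ∀ {X x} → Related X x f → ∃ᶜ λ p → Σ[ n ∈ Carrier ] p ε A × Code p X x n
      f-elim h = do
        (g , h₁) ← h
        (g∈f , g≡) ← h₁
        (n , h₂) ← snd (to (f≡ g) g∈f)
        (p , h₃) ← h₂
        (p∈A , p≡) ← h₃
        p & n , p∈A , g & g≡ & p≡

      pairs : ∀ g → g ε f → ∃ᶜ λ X → ∃ᶜ λ x → Pair g X x
      pairs g g∈f = do
        (X , h) ← to (G≡ g) (fst (to (f≡ g) g∈f))
        (x , h₁) ← snd h
        X & x & snd h₁

      -- Two triples of `A` over the same `X` are compatible, so they cannot be distinct.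
      single-valued : ∀ X x y → Related X x f ∧ᶜ Related X y f → x ≈ y
      single-valued X x y h = do
        (Xfx , Xfy) ← h
        (p , n , p∈A , p≡) ← f-elim Xfx
        (q , m , q∈A , q≡) ← f-elim Xfy
        stable λ x≉y → antichain p p∈A q q∈A
          (λ p≈q → x≉y (proj₁ (proj₂ (Code-injective p≈q p≡ q≡))))
          (fiber-compatible (A⊆P p p∈A) (A⊆P q q∈A) p≡ q≡)

      -- Maximality is applied to the triple of `X`, some `x` in it and zero. The triple of `A`
      -- compatible with it also lies over `X`, and its own second component `y` is the value.
      choice : ∀ X → X ε F → ∃ᶜ λ x → x ε X ∧ᶜ Related X x f
      choice X X∈F = do
        (x , x∈X) ← nonempty X X∈F
        (e , h) ← zero-exists
        (p , h₁) ← code-exists X∈F x∈X (fst h)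
        (p∈P , p≡) ← h₁
        (q , h₂) ← maximal p p∈P
        (q∈A , compatible) ← h₂
        (Y , y , m , _ , y∈Y , _ , q≡) ← P-view (A⊆P q q∈A)
        let Y≈X = ≈-sym (compatible-fiber compatible p≡ q≡)
        y & ε-congʳ Y≈X y∈Y & f-intro q∈A (Code-replace Y≈X q≡)

      domain : ∀ X → X ε F ⇔ᶜ (∃ᶜ λ x → Related X x f)
      domain X =
        (λ X∈F → do
          (x , h) ← choice X X∈F
          x & snd h)
        & λ h → do
          (x , Xfx) ← h
          (p , n , p∈A , p≡) ← f-elim Xfx
          proj₁ (components (A⊆P p p∈A) p≡)

      choice-function : ⟦ IsChoiceFunction v0 v1 ⟧ (f ◂ F ◂ []ᶠ)
      choice-function = (pairs & single-valued) & domain & choice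

  antichain⇒choice : M ⊨ MaximalAntichainPrinciple → M ⊨ AxiomOfChoice
  antichain⇒choice principle F nonempty = do
    (w , omega) ← omega-exists
    (U , U≡) ← union-exists F
    (FU , FU≡) ← product-exists F U
    -- `G` is the disjoint union of the members of `F`.
    (G , G≡) ← axm (separation-ax 1 (∃[∈ v2 ] ∃[∈ v0 ] IsPair v2 v1 v0)) F FU
    (P , P≡) ← product-exists G w
    (PP , PP≡) ← product-exists P P
    (R , R≡) ← axm (separation-ax 0 (∃′ ∃′ IsPair v2 v1 v0 ∧ IsBelow v1 v0)) PP
    let G≡′ = λ g → (λ g∈G → snd (to (G≡ g) g∈G)) & λ h → from (G≡ g) ((do
          (X , h₁) ← h
          (X∈F , h₂) ← h₁
          (x , h₃) ← h₂
          (x∈X , g≡) ← h₃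
          from (FU≡ g) (X & X∈F & x & from (U≡ x) (X & X∈F & x∈X) & g≡)) & h)
        open Fibers omega G≡′ P≡ PP≡ R≡
    (A , h) ← principle P R partial-order
    (antichain , maximal) ← h
    -- Dropping the third components of `A` leaves the graph of the choice function.
    (f , f≡) ← axm (separation-ax 1 (∃′ ∃′ v0 ∈ v4 ∧ IsPair v0 v2 v1)) A G
    f & Choose.choice-function nonempty (fst antichain) (snd antichain) maximal f≡

-- From choice to maximal antichains

IsExternal : ∀ {n} → Fin n → Fin n → Fin n → Fin n → Formula n
IsExternal E A P R =
  ∀′ v0 ∈ suc E ⇔
     v0 ∈ suc P ∧ (∀[∈ suc A ] ¬ Compatible (suc (suc P)) (suc (suc R)) v1 v0)

-- A relation rather than a function: when `f` chooses from nonempty sets only, `A` has no next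
-- point once nothing is external to it.
IsNext : ∀ {n} → Fin n → Fin n → Fin n → Fin n → Fin n → Formula n
IsNext x A P R f = ∃′ IsExternal v0 (suc A) (suc P) (suc R) ∧ ⟨ v0 , suc x ⟩∈ suc f

IsStep : ∀ {n} → Fin n → Fin n → Fin n → Fin n → Fin n → Formula n
IsStep B A P R f =
  ∃′ IsNext v0 (suc A) (suc P) (suc R) (suc f)
     ∧ (∀′ v0 ∈ suc (suc B) ⇔ v0 ∈ suc (suc A) ∨ v0 ≐ v1)

-- The union of the empty subset puts the empty set into every tower, which is where the
-- construction starts.
IsTower : ∀ {n} → Fin n → Fin n → Fin n → Fin n → Formula n
IsTower T P R f =
    (∀[∈ T ] ∀′ IsStep v0 v1 (suc (suc P)) (suc (suc R)) (suc (suc f)) ⇒ v0 ∈ suc (suc T))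
  ∧ (∀′ v0 ⊆ suc T ⇒ (∀′ (∀′ v0 ∈ v1 ⇔ (∃[∈ v2 ] v1 ∈ v0)) ⇒ v0 ∈ suc (suc T)))

module ChoiceToAntichain (M : Structure) (zf : ∀ {φ} → ZF ⊢ φ → M ⊨ φ) where

  open Structure M
  open ClassicalLogic M
  open SetTheory M zf

  module Towers {P R f Q : Carrier}
    (Q≡ : ∀ A → A ε Q ⇔ᶜ A ⊑ P)
    (reflexive : ∀ p → p ε P → Related p p R)
    (single-valued : ∀ E x y → Related E x f ∧ᶜ Related E y f → x ≈ y)
    (choice : ∀ E → E ⊑ P → (∃ᶜ λ x → x ε E) → ∃ᶜ λ x → x ε E ∧ᶜ Related E x f)
    (chosen : ∀ E x → Related E x f → x ε E) where

    Compatible-sym : ∀ {p q} → CompatibleIn P R p q → CompatibleIn P R q p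
    Compatible-sym h = do
      (r , h₁) ← h
      (r∈P , h₂) ← h₁
      (rRp , rRq) ← h₂
      r & r∈P & rRq & rRp

    Compatible-refl : ∀ {p} → p ε P → CompatibleIn P R p p
    Compatible-refl {p} p∈P = p & p∈P & reflexive p p∈P & reflexive p p∈P

    External : Carrier → Carrier → Set
    External E A = ∀ p → p ε E ⇔ᶜ (p ε P ∧ᶜ (∀ q → q ε A → CompatibleIn P R p q → Falsity))

    Next : Carrier → Carrier → Set
    Next x A = ∃ᶜ λ E → External E A ∧ᶜ Related E x f

    Adjoin : Carrier → Carrier → Carrier → Set
    Adjoin B A x = ∀ z → z ε B ⇔ᶜ (z ε A ∨ᶜ z ≈ x)

    Step : Carrier → Carrier → Set
    Step B A = ∃ᶜ λ x → Next x A ∧ᶜ Adjoin B A x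

    Tower : Carrier → Set
    Tower T = (∀ A → A ε T → ∀ B → Step B A → B ε T)
            ∧ᶜ (∀ S → S ⊑ T → ∀ U → Union U S → U ε T)

    Next-unique : ∀ {x y A B} → A ≈ B → Next x A → Next y B → x ≈ y
    Next-unique {x} {y} {A} {B} e hx hy = do
      (E , h) ← hx
      (E≡ , Ex) ← h
      (E′ , h′) ← hy
      (E′≡ , E′y) ← h′
      let E≡′ = replace (IsExternal v1 v0 v2 v3) (E ◂ P ◂ R ◂ []ᶠ) e E≡
          Ey = replace (⟨ v0 , v1 ⟩∈ v2) (y ◂ f ◂ []ᶠ) (ext⇔ E′≡ E≡′) E′y
      single-valued E x y (Ex & Ey)

    -- The least tower

    module Least {K : Carrier}
      (K≡ : ∀ A → A ε K ⇔ᶜ (A ε Q ∧ᶜ (∀ T → Tower T → A ε T))) where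

      Next-external : ∀ {x A} → Next x A → x ε P × (∀ q → q ε A → CompatibleIn P R x q → Falsity)
      Next-external {x} hx = do
        (E , h) ← hx
        (E≡ , Ex) ← h
        (x∈P , incompatible) ← to (E≡ x) (chosen E x Ex)
        x∈P , incompatible

      ⊑P : ∀ {A} → A ε K → A ⊑ P
      ⊑P {A} A∈K = to (Q≡ A) (fst (to (K≡ A) A∈K))

      least : ∀ T → Tower T → K ⊑ T
      least T tower A A∈K = snd (to (K≡ A) A∈K) T tower

      step-closed : ∀ A → A ε K → ∀ B → Step B A → B ε K
      step-closed A A∈K B step = from (K≡ B)
        (from (Q≡ B) (λ z z∈B → do
          (x , h) ← step
          (next , B≡) ← h
          either (to (B≡ z) z∈B) (⊑P A∈K z)
            (λ z≈x → ε-congˡ (≈-sym z≈x) (proj₁ (Next-external next))))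
        & λ T tower → fst tower A (least T tower A A∈K) B step)

      union-closed : ∀ S → S ⊑ K → ∀ U → Union U S → U ε K
      union-closed S S⊑K U U≡ = from (K≡ U)
        (from (Q≡ U) (λ z z∈U → do
          (A , h) ← to (U≡ z) z∈U
          (A∈S , z∈A) ← h
          ⊑P (S⊑K A A∈S) z z∈A)
        & λ T tower → snd tower S (λ A A∈S → least T tower A (S⊑K A A∈S)) U U≡)

      -- The members of `K` that satisfy `Φ` form a tower, and `K` lies in every tower. As in
      -- `induction`, `separated` says that they form a set.
      tower-induction : {Φ : Carrier → Set} → {{∀ {A} → Stable (Φ A)}} →
        (∃ᶜ λ T → ∀ A → A ε T ⇔ᶜ (A ε K ∧ᶜ Φ A)) →
        (∀ A B x → A ε K → B ε K → Next x A → Adjoin B A x → Φ A → Φ B) →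
        (∀ S U → S ⊑ K → Union U S → (∀ A → A ε S → Φ A) → Φ U) →
        ∀ A → A ε K → Φ A
      tower-induction separated step union A A∈K = do
        (T , T≡) ← separated
        let steps = λ A A∈T B A↦B → do
              (A∈K , ΦA) ← to (T≡ A) A∈T
              (x , h) ← A↦B
              (next , B≡) ← h
              let B∈K = step-closed A A∈K B A↦B
              from (T≡ B) (B∈K & step A B x A∈K B∈K next B≡ ΦA)
            unions = λ S S⊑T U U≡ →
              let S⊑K = λ A A∈S → fst (to (T≡ A) (S⊑T A A∈S))
              in from (T≡ U) (union-closed S S⊑K U U≡
                   & union S U S⊑K U≡ (λ A A∈S → snd (to (T≡ A) (S⊑T A A∈S))))
        snd (to (T≡ A) (least T (steps & unions) A A∈K))

      Comparable : Carrier → Set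
      Comparable C = ∀ A → A ε K → A ⊑ C ∨ᶜ C ⊑ A

      Adjoin-⊑ : ∀ {B A x D} → Adjoin B A x → A ⊑ D → x ε D → B ⊑ D
      Adjoin-⊑ B≡ A⊑D x∈D z z∈B =
        either (to (B≡ z) z∈B) (A⊑D z) (λ z≈x → ε-congˡ (≈-sym z≈x) x∈D)

      ⊑-Adjoin : ∀ {B A x} → Adjoin B A x → A ⊑ B
      ⊑-Adjoin B≡ z z∈A = from (B≡ z) (inl z∈A)

      x∈Adjoin : ∀ {B A x} → Adjoin B A x → x ε B
      x∈Adjoin B≡ = from (B≡ _) (inr ≈-refl)

      -- No member of K lies strictly between C and C with its next point.
      gap : ∀ C → C ε K → Comparable C → ∀ A → A ε K →
            A ⊑ C ∨ᶜ (C ⊑ A ∧ᶜ (∀ x → Next x C → x ε A))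
      gap C C∈K comparable = tower-induction
        (axm (separation-ax 4 (v0 ⊆ v2 ∨ (v2 ⊆ v0 ∧ (∀′ IsNext v0 v3 v4 v5 v6 ⇒ v0 ∈ v1))))
          f R P C K)
        (λ A B x A∈K B∈K next B≡ ΦA → either ΦA
          -- If `B` is not inside `C`, the adjoined point is outside `C`, so `C ⊑ B` forces `C ⊑ A`.
          -- Then `A` equals `C`, and the adjoined point is the next point of `C`.
          (λ A⊑C → either (comparable B B∈K) inl λ C⊑B → λ B⋢C →
            let C⊑A = λ z z∈C → either (to (B≡ z) (C⊑B z z∈C)) id
                        (λ z≈x → explode (B⋢C (Adjoin-⊑ B≡ A⊑C (ε-congˡ z≈x z∈C))))
            in C⊑B & λ y next′ →
                 ε-congˡ (Next-unique (ext A⊑C C⊑A) next next′) (x∈Adjoin B≡))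
          (λ h → inr ((λ z z∈C → ⊑-Adjoin B≡ z (fst h z z∈C))
                     & λ y next′ → ⊑-Adjoin B≡ y (snd h y next′))))
        -- Either every member of `S` is inside `C`, and so is `U`, or one contains `C` and its next
        -- point, and so does `U`.
        (λ S U S⊑K U≡ ΦS U⋢C → stable λ ¬right → U⋢C λ z z∈U → do
          (A , h) ← to (U≡ z) z∈U
          (A∈S , z∈A) ← h
          either (ΦS A A∈S) (λ A⊑C → A⊑C z z∈A)
            (λ h′ → explode (¬right
              ((λ t t∈C → from (U≡ t) (A & A∈S & fst h′ t t∈C))
              & λ x next → from (U≡ x) (A & A∈S & snd h′ x next)))))

      -- Induction on `C`, with `gap` as the step. At a union, a set not inside `U` is inside no
      -- member of `S`, so it contains all of them.
      chain : ∀ C → C ε K → Comparable C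
      chain = tower-induction
        (axm (separation-ax 0 (∀[∈ v1 ] v0 ⊆ v1 ∨ v1 ⊆ v0)) K)
        (λ C B x C∈K B∈K next B≡ comparable A A∈K → either (gap C C∈K comparable A A∈K)
          (λ A⊑C → inl λ z z∈A → ⊑-Adjoin B≡ z (A⊑C z z∈A))
          (λ h → inr (Adjoin-⊑ B≡ (fst h) (snd h x next))))
        (λ S U S⊑K U≡ comparable A A∈K A⋢U z z∈U → do
          (C , h) ← to (U≡ z) z∈U
          (C∈S , z∈C) ← h
          either (comparable C C∈S A A∈K)
            (λ A⊑C → explode (A⋢U λ t t∈A → from (U≡ t) (C & C∈S & A⊑C t t∈A)))
            (λ C⊑A → C⊑A z z∈C))

      IsPairwiseIncompatible : Carrier → Set
      IsPairwiseIncompatible A =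
        ∀ p → p ε A → ∀ q → q ε A → (p ≈ q → Falsity) → CompatibleIn P R p q → Falsity

      Compatible-replace : ∀ {p p′ q q′} → p ≈ p′ → q ≈ q′ →
                           CompatibleIn P R p q → CompatibleIn P R p′ q′
      Compatible-replace {p} {p′} {q} {q′} e e′ =
        ⟦⟧-cong (Compatible v2 v3 v0 v1) {p ◂ q ◂ P ◂ R ◂ []ᶠ} {p′ ◂ q′ ◂ P ◂ R ◂ []ᶠ}
          λ { v0 → e ; v1 → e′ ; v2 → ≈-refl ; v3 → ≈-refl }

      -- A step adjoins a point incompatible with all earlier ones; in a union, `chain` puts any two
      -- points into a common member.
      pairwise : ∀ A → A ε K → A ⊑ P ∧ᶜ IsPairwiseIncompatible A
      pairwise = tower-induction
        (axm (separation-ax 2 (IsAntichain v2 v3 v0)) R P K)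
        (λ A B x A∈K B∈K next B≡ ΦA →
          let _ , x⊥A = Next-external next
          in ⊑P B∈K & λ p p∈B q q∈B p≉q compatible →
               either (to (B≡ p) p∈B)
                 (λ p∈A → either (to (B≡ q) q∈B)
                   (λ q∈A → snd ΦA p p∈A q q∈A p≉q compatible)
                   (λ q≈x → x⊥A p p∈A (Compatible-sym (Compatible-replace ≈-refl q≈x compatible))))
                 (λ p≈x → either (to (B≡ q) q∈B)
                   (λ q∈A → x⊥A q q∈A (Compatible-replace p≈x ≈-refl compatible))
                   (λ q≈x → p≉q (≈-trans p≈x (≈-sym q≈x)))))
        (λ S U S⊑K U≡ ΦS → ⊑P (union-closed S S⊑K U U≡) & λ p p∈U q q∈U p≉q compatible → do
          (A , h) ← to (U≡ p) p∈U
          (A∈S , p∈A) ← h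
          (B , h′) ← to (U≡ q) q∈U
          (B∈S , q∈B) ← h′
          either (chain A (S⊑K A A∈S) B (S⊑K B B∈S))
            (λ B⊑A → snd (ΦS A A∈S) p p∈A q (B⊑A q q∈B) p≉q compatible)
            (λ A⊑B → snd (ΦS B B∈S) p (A⊑B p p∈A) q q∈B p≉q compatible))

      -- Otherwise `U` has a next point `x`. The step from `U` stays in `K`, whose union is `U`, so
      -- `x` is already in `U`; but `x` is incompatible with every element of `U` and compatible
      -- with itself.
      top-maximal : ∀ U → Union U K → ∀ p → p ε P → ∃ᶜ λ q → q ε U ∧ᶜ CompatibleIn P R p q
      top-maximal U U≡ p p∈P none = do
        (E , E≡) ← axm (separation-ax 2 (∀[∈ v2 ] ¬ Compatible v2 v4 v1 v0)) R U P
        let p∈E = from (E≡ p) (p∈P & λ q q∈U compatible → none q (q∈U & compatible))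
        (x , h) ← choice E (λ z z∈E → fst (to (E≡ z) z∈E)) (p & p∈E)
        (x∈E , Ex) ← h
        (s , s≡) ← pairing-exists x x
        (d , d≡) ← pairing-exists U s
        (B , B≡) ← union-exists d
        let next : Next x U
            next = E & E≡ & Ex
            U∈K = union-closed K (λ _ → id) U U≡
            adjoin : Adjoin B U x
            adjoin = λ z →
              (λ z∈B → do
                (t , h′) ← to (B≡ z) z∈B
                (t∈d , z∈t) ← h′
                either (to (d≡ t) t∈d)
                  (λ t≈U → inl (ε-congʳ t≈U z∈t))
                  (λ t≈s → inr (either (to (s≡ z) (ε-congʳ t≈s z∈t)) id id)))
              & λ h′ → either h′
                  (λ z∈U → from (B≡ z) (U & from (d≡ U) (inl ≈-refl) & z∈U))
                  (λ z≈x → from (B≡ z) (s & from (d≡ s) (inr ≈-refl) & from (s≡ z) (inl z≈x)))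
            B∈K = step-closed U U∈K B (x & next & adjoin)
            x∈U = from (U≡ x) (B & B∈K & x∈Adjoin adjoin)
            x∈P , x⊥U = Next-external next
        x⊥U x x∈U (Compatible-refl x∈P)

  choice⇒antichain : M ⊨ AxiomOfChoice → M ⊨ MaximalAntichainPrinciple
  choice⇒antichain choice P R order = do
    (Q , Q≡) ← power-exists P
    (F , F≡) ← axm (separation-ax 0 (¬ Empty v0)) Q
    (f , h) ← choice F (λ E E∈F → snd (to (F≡ E) E∈F))
    (function , h₁) ← h
    (domain , picks) ← h₁
    let single-valued = snd function
        pick = λ E E⊑P nonempty → picks E (from (F≡ E) (from (Q≡ E) E⊑P & nonempty))
        -- The domain of `f` is `F`, where `f` has a value inside its argument; by single-valuedness
        -- there is no other value.
        chosen = λ E x Ex → do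
          (y , h₂) ← picks E (from (domain E) (x & Ex))
          (y∈E , Ey) ← h₂
          ε-congˡ (single-valued E y x (Ey & Ex)) y∈E
        open Towers Q≡ (fst (snd order)) single-valued pick chosen
    -- The intersection of all towers, within the power set of `P`.
    (K , K≡) ← axm (separation-ax 3 (∀′ IsTower v0 v3 v4 v5 ⇒ v1 ∈ v0)) f R P Q
    (U , U≡) ← union-exists K
    let open Least K≡
    U & pairwise U (union-closed K (λ _ → id) U U≡) & top-maximal U U≡

theorem1 : ZF ⊢ (AxiomOfChoice ⇔ MaximalAntichainPrinciple)
-- Infinity is an existential sentence, so as an axiom it shows that the universe is inhabited.
theorem1 = completeness (axiom infinity-ax) λ M zf →
  let open ClassicalLogic M
  in ChoiceToAntichain.choice⇒antichain M zf & AntichainToChoice.antichain⇒choice M zf
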